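{- Let $p$ be a prime and $k$ a positive integer. The number of $2\times 2$ matrices with entries in $\mathbb{Z}_{p^k}$ that are diagonalizable over $\mathbb{Z}_{p^k}$ is $$|\mathrm{Diag}_2(\mathbb{Z}_{p^k})| = p^k + \frac{p^{k+1}(p^2-1)(p^{3k}-1)}{2(p^3-1)}.$$
   Context: $\mathbb{Z}_{p^k}$ denotes the ring of integers modulo $p^k$. A matrix $A\in M_n(\mathbb{Z}_{p^k})$ is diagonalizable over $\mathbb{Z}_{p^k}$ if $A = PDP^{ -1}$ for some invertible $P\in GL_n(\mathbb{Z}_{p^k})$ and some diagonal $D\in M_n(\mathbb{Z}_{p^k})$. $\mathrm{Diag}_n(\mathbb{Z}_{p^k})$ denotes the set of all $n\times n$ matrices over $\mathbb{Z}_{p^k}$ that are diagonalizable over $\mathbb{Z}_{p^k}$. -}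

module Defs where

open import Algebra.Bundles using (CommutativeRing)
import Algebra.Definitions.RawMonoid as RawMonoidDefs
open import Algebra.Structures using (IsCommutativeRing)
open import Data.Bool.Base using (if_then_else_)
open import Data.Fin.Base using (Fin; toℕ)
open import Data.Fin.Properties using (_≟_; toℕ-fromℕ<; toℕ-injective; toℕ<n; toℕ≤n)
open import Data.Nat.Base
  using (ℕ; NonZero; _+_; _*_; _∸_; _^_; _<_; z<s; >-nonZero⁻¹; ≢-nonZero; nonTrivial⇒n>1)
open import Data.Nat.DivMod using (_%_; _mod_; m%n<n; m<n⇒m%n≡m; n%n≡0; %-distribˡ-+; %-distribˡ-*)
open import Data.Nat.Primality using (Prime; prime⇒nonZero; prime⇒nonTrivial)
open import Data.Nat.Properties
  using (+-comm; +-assoc; *-comm; *-assoc; *-identityˡ; *-distribˡ-+; m∸n+n≡m; m^n≢0; m*n≢0; ^-monoʳ-<; m>n⇒m∸n≢0)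
open import Data.Product.Base using (_,_; proj₁)
import Data.Vec.Functional.Relation.Binary.Equality.Setoid as VecEq
open import Function.Bundles using (Bijection)
open import Level using (Level; _⊔_)
open import Relation.Binary.Bundles using (Setoid)
import Relation.Binary.Construct.On as On
open import Relation.Binary.PropositionalEquality as ≡
  using (_≡_; _≢_; sym; trans; cong; cong₂; isEquivalence; module ≡-Reasoning)
open import Relation.Nullary.Decidable.Core using (does)

private
  variable
    c ℓ : Level

-- ℤ/mℤ on canonical representatives: an operation on residues is the
-- operation on ℕ followed by reduction.

module Residue (m : ℕ) .{{_ : NonZero m}} where

  infixl 6 _⊕_
  infixl 7 _⊗_
  infix  8 ⊖_

  [_] : ℕ → Fin m
  [ x ] = x mod m

  _⊕_ _⊗_ : Fin m → Fin m → Fin m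
  a ⊕ b = [ toℕ a + toℕ b ]
  a ⊗ b = [ toℕ a * toℕ b ]

  ⊖_ : Fin m → Fin m
  ⊖ a = [ m ∸ toℕ a ]

  toℕ-[] : ∀ x → toℕ [ x ] ≡ x % m
  toℕ-[] x = toℕ-fromℕ< (m%n<n x m)

  []-cong : ∀ {x y} → x % m ≡ y % m → [ x ] ≡ [ y ]
  []-cong {x} {y} eq = toℕ-injective (trans (toℕ-[] x) (trans eq (sym (toℕ-[] y))))

  []-toℕ : ∀ a → [ toℕ a ] ≡ a
  []-toℕ a = toℕ-injective (trans (toℕ-[] (toℕ a)) (m<n⇒m%n≡m (toℕ<n a)))

  []-+ : ∀ x y → [ x ] ⊕ [ y ] ≡ [ x + y ]
  []-+ x y = []-cong (trans
    (cong₂ (λ u v → (u + v) % m) (toℕ-[] x) (toℕ-[] y))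
    (sym (%-distribˡ-+ x y m)))

  []-* : ∀ x y → [ x ] ⊗ [ y ] ≡ [ x * y ]
  []-* x y = []-cong (trans
    (cong₂ (λ u v → (u * v) % m) (toℕ-[] x) (toℕ-[] y))
    (sym (%-distribˡ-* x y m)))

  []-+ˡ : ∀ x a → [ x ] ⊕ a ≡ [ x + toℕ a ]
  []-+ˡ x a = trans (cong ([ x ] ⊕_) (sym ([]-toℕ a))) ([]-+ x (toℕ a))

  []-*ˡ : ∀ x a → [ x ] ⊗ a ≡ [ x * toℕ a ]
  []-*ˡ x a = trans (cong ([ x ] ⊗_) (sym ([]-toℕ a))) ([]-* x (toℕ a))

  ⊕-comm : ∀ a b → a ⊕ b ≡ b ⊕ a
  ⊕-comm a b = cong [_] (+-comm (toℕ a) (toℕ b))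

  ⊗-comm : ∀ a b → a ⊗ b ≡ b ⊗ a
  ⊗-comm a b = cong [_] (*-comm (toℕ a) (toℕ b))

  ⊕-assoc : ∀ a b d → (a ⊕ b) ⊕ d ≡ a ⊕ (b ⊕ d)
  ⊕-assoc a b d = begin
    (a ⊕ b) ⊕ d                   ≡⟨ []-+ˡ _ d ⟩
    [ toℕ a + toℕ b + toℕ d ]     ≡⟨ cong [_] (+-assoc (toℕ a) (toℕ b) (toℕ d)) ⟩
    [ toℕ a + (toℕ b + toℕ d) ]   ≡⟨ cong [_] (+-comm (toℕ a) _) ⟩
    [ toℕ b + toℕ d + toℕ a ]     ≡⟨ []-+ˡ _ a ⟨
    (b ⊕ d) ⊕ a                   ≡⟨ ⊕-comm (b ⊕ d) a ⟩
    a ⊕ (b ⊕ d)                   ∎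
    where open ≡-Reasoning

  ⊗-assoc : ∀ a b d → (a ⊗ b) ⊗ d ≡ a ⊗ (b ⊗ d)
  ⊗-assoc a b d = begin
    (a ⊗ b) ⊗ d                   ≡⟨ []-*ˡ _ d ⟩
    [ toℕ a * toℕ b * toℕ d ]     ≡⟨ cong [_] (*-assoc (toℕ a) (toℕ b) (toℕ d)) ⟩
    [ toℕ a * (toℕ b * toℕ d) ]   ≡⟨ cong [_] (*-comm (toℕ a) _) ⟩
    [ toℕ b * toℕ d * toℕ a ]     ≡⟨ []-*ˡ _ a ⟨
    (b ⊗ d) ⊗ a                   ≡⟨ ⊗-comm (b ⊗ d) a ⟩
    a ⊗ (b ⊗ d)                   ∎
    where open ≡-Reasoning

  ⊕-identityˡ : ∀ a → [ 0 ] ⊕ a ≡ a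
  ⊕-identityˡ a = trans ([]-+ˡ 0 a) ([]-toℕ a)

  ⊗-identityˡ : ∀ a → [ 1 ] ⊗ a ≡ a
  ⊗-identityˡ a = trans ([]-*ˡ 1 a) (trans (cong [_] (*-identityˡ (toℕ a))) ([]-toℕ a))

  ⊖-inverseˡ : ∀ a → (⊖ a) ⊕ a ≡ [ 0 ]
  ⊖-inverseˡ a = begin
    (⊖ a) ⊕ a               ≡⟨ []-+ˡ _ a ⟩
    [ m ∸ toℕ a + toℕ a ]   ≡⟨ cong [_] (m∸n+n≡m (toℕ≤n a)) ⟩
    [ m ]                   ≡⟨ []-cong (trans (n%n≡0 m) (sym (m<n⇒m%n≡m (>-nonZero⁻¹ m)))) ⟩
    [ 0 ]                   ∎
    where open ≡-Reasoning

  ⊗-distribˡ-⊕ : ∀ a b d → a ⊗ (b ⊕ d) ≡ (a ⊗ b) ⊕ (a ⊗ d)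
  ⊗-distribˡ-⊕ a b d = begin
    a ⊗ (b ⊕ d)                           ≡⟨ ⊗-comm a (b ⊕ d) ⟩
    (b ⊕ d) ⊗ a                           ≡⟨ []-*ˡ _ a ⟩
    [ (toℕ b + toℕ d) * toℕ a ]           ≡⟨ cong [_] (*-comm (toℕ b + toℕ d) (toℕ a)) ⟩
    [ toℕ a * (toℕ b + toℕ d) ]           ≡⟨ cong [_] (*-distribˡ-+ (toℕ a) (toℕ b) (toℕ d)) ⟩
    [ toℕ a * toℕ b + toℕ a * toℕ d ]     ≡⟨ []-+ _ _ ⟨
    (a ⊗ b) ⊕ (a ⊗ d)                     ∎
    where open ≡-Reasoning

  isCommutativeRing : IsCommutativeRing _≡_ _⊕_ _⊗_ ⊖_ [ 0 ] [ 1 ]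
  isCommutativeRing = record
    { isRing = record
      { +-isAbelianGroup = record
        { isGroup = record
          { isMonoid = record
            { isSemigroup = record
              { isMagma = record { isEquivalence = isEquivalence ; ∙-cong = cong₂ _⊕_ }
              ; assoc   = ⊕-assoc
              }
            ; identity = ⊕-identityˡ , λ a → trans (⊕-comm a _) (⊕-identityˡ a)
            }
          ; inverse = ⊖-inverseˡ , λ a → trans (⊕-comm a _) (⊖-inverseˡ a)
          ; ⁻¹-cong = cong ⊖_
          }
        ; comm = ⊕-comm
        }
      ; *-cong     = cong₂ _⊗_
      ; *-assoc    = ⊗-assoc
      ; *-identity = ⊗-identityˡ , λ a → trans (⊗-comm a _) (⊗-identityˡ a)
      ; distrib    = ⊗-distribˡ-⊕ , λ a b d → trans (⊗-comm (b ⊕ d) a)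
                       (trans (⊗-distribˡ-⊕ a b d) (cong₂ _⊕_ (⊗-comm a b) (⊗-comm a d)))
      }
    ; *-comm = ⊗-comm
    }

ℤ/ : (m : ℕ) .{{_ : NonZero m}} → CommutativeRing _ _
ℤ/ m = record { isCommutativeRing = Residue.isCommutativeRing m }

module Matrices (R : CommutativeRing c ℓ) where
  open CommutativeRing R using (Carrier; _≈_; 0#; 1#; setoid; +-rawMonoid) renaming (_*_ to _·_)
  open RawMonoidDefs +-rawMonoid using (sum)

  infix  4 _≋_
  infixl 7 _⊠_

  Matrix : ℕ → Set c
  Matrix n = Fin n → Fin n → Carrier

  matrixSetoid : ℕ → Setoid c ℓ
  matrixSetoid n = VecEq.≋-setoid (VecEq.≋-setoid setoid n) n

  _≋_ : ∀ {n} → Matrix n → Matrix n → Set ℓ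
  _≋_ {n} = Setoid._≈_ (matrixSetoid n)

  _⊠_ : ∀ {n} → Matrix n → Matrix n → Matrix n
  (A ⊠ B) i j = sum λ l → A i l · B l j

  identity : ∀ {n} → Matrix n
  identity i j = if does (i ≟ j) then 1# else 0#

  IsDiagonal : ∀ {n} → Matrix n → Set ℓ
  IsDiagonal D = ∀ i j → i ≢ j → D i j ≈ 0#

  record Diagonalizable {n} (A : Matrix n) : Set (c ⊔ ℓ) where
    field
      P P⁻¹ D    : Matrix n
      P⊠P⁻¹      : P ⊠ P⁻¹ ≋ identity
      P⁻¹⊠P      : P⁻¹ ⊠ P ≋ identity
      D-diagonal : IsDiagonal D
      A≋PDP⁻¹    : A ≋ P ⊠ D ⊠ P⁻¹

-- Two elements are identified when their matrices are entrywise equal; the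
-- choice of P and D witnessing diagonalizability is irrelevant.

Diag : (n : ℕ) (R : CommutativeRing c ℓ) → Setoid (c ⊔ ℓ) ℓ
Diag n R = On.setoid (matrixSetoid n) (proj₁ {B = Diagonalizable})
  where open Matrices R

HasCardinality : Setoid c ℓ → ℕ → Set (c ⊔ ℓ)
HasCardinality S N = Bijection (≡.setoid (Fin N)) S

prime^-nonZero : ∀ {p} → Prime p → ∀ k → NonZero (p ^ k)
prime^-nonZero {p} p-prime k = m^n≢0 p k {{prime⇒nonZero p-prime}}

2[p³∸1]-nonZero : ∀ {p} → Prime p → NonZero (2 * (p ^ 3 ∸ 1))
2[p³∸1]-nonZero {p} p-prime = m*n≢0 2 (p ^ 3 ∸ 1)
  {{_}} {{≢-nonZero (m>n⇒m∸n≢0 1<p³)}}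
  where
  1<p³ : 1 < p ^ 3
  1<p³ = ^-monoʳ-< p (nonTrivial⇒n>1 p {{prime⇒nonTrivial p-prime}}) {0} {3} z<s

{-# OPTIONS --safe #-}

-- A is diagonalizable iff A = y + (x − y) v wᵀ with w·v = 1. Over R = ℤ/p^(k+1),
-- either x ≡ y mod p, and A = a + pB for a residue a and a diagonalizable B over
-- S = ℤ/p^k, or x − y is a unit. In the second case the discriminant (x − y)² is a
-- unit, so the two cases exclude each other; trace and determinant determine
-- {x, y}, which is ordered by its residues mod p; and since R is local, vwᵀ has
-- either v = (1, γ) or v = (γ, 1) with γ ∈ pR, with one further parameter in R.
-- Hence N(k+1) = p N(k) + p(p−1)/2 · p^(2k) · (p^(2k+2) + p^(2k+1)), and N(0) = 1.
module Submission where

open import Defs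
open import Algebra.Bundles using (CommutativeRing)
open import Algebra.Core using (Op₁; Op₂)
import Algebra.Properties.AbelianGroup as AbelianGroupProperties
import Algebra.Properties.Group as GroupProperties
import Algebra.Properties.Ring as RingProperties
import Algebra.Properties.Semiring.Mult.TCOptimised as Mult
import Algebra.Solver.Ring as RingSolver
open import Algebra.Solver.Ring.AlmostCommutativeRing
  using (fromCommutativeRing; _-Raw-AlmostCommutative⟶_)
open import Algebra.Structures using (IsCommutativeRing)
open import Data.Empty using (⊥; ⊥-elim)
open import Data.Fin.Base as Fin using (Fin; toℕ; zero; suc)
import Data.Fin.Properties as Fin
open import Data.Integer.Base as ℤ using (ℤ; +_; -[1+_])
import Data.Integer.Properties as ℤ
open import Data.Maybe.Base as Maybe using (Maybe)
open import Data.Nat.Base as ℕ using (ℕ; zero; suc; NonZero; z<s; s<s)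
open import Data.Nat.Coprimality using (Coprime; coprime-divisor; coprime-Bézout)
open import Data.Nat.Divisibility using (_∣_; _∣?_; divides; ∣-trans; ∣1⇒≡1; m∣m*n; m%n≡0⇒n∣m)
open import Data.Nat.GCD using (module Bézout)
open import Data.Nat.Primality using (Prime; prime⇒nonZero; prime⇒nonTrivial; prime⇒irreducible)
import Data.Nat.Properties as ℕ
import Data.Nat.Solver as ℕSolver
open import Data.Product.Base using (Σ; Σ-syntax; ∃-syntax; ∃₂; _×_; _,_; proj₁; proj₂; map; map₂)
open import Data.Product.Function.NonDependent.Propositional using (_×-↔_)
import Data.Rational.Base as ℚ
import Data.Rational.Properties as ℚ
import Data.Rational.Unnormalised.Base as ℚᵘ
import Data.Rational.Unnormalised.Properties as ℚᵘ
open import Data.Sum.Base as Sum using (_⊎_; inj₁; inj₂)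
open import Data.Sum.Function.Propositional using (_⊎-↔_)
open import Data.Unit.Base using (⊤; tt)
open import Function.Bundles using (Inverse; _↔_; mk↔ₛ′)
open import Function.Definitions using (Injective)
open import Function.Properties.Inverse using (↔-refl; ↔-sym; ↔-trans)
open import Level using (Level; 0ℓ)
open import Relation.Binary.Definitions using (tri<; tri≈; tri>)
open import Relation.Binary.PropositionalEquality as ≡
  using (_≡_; _≢_; refl; sym; trans; cong; cong₂; module ≡-Reasoning)
import Relation.Binary.Reasoning.Setoid as SetoidReasoning
open import Relation.Nullary.Decidable.Core using (yes; no; dec⇒maybe)
open import Relation.Nullary.Negation.Core using (¬_)

-- Two obstacles shape the argument: 2 need not be a unit, so there is no quadratic formula, and R
-- may have zero divisors, so (x - x′)(x - y′) = 0 identifies an eigenvalue only when one factor is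
-- a unit. Passing from P to E = v wᵀ discards most of the redundancy of P: given E, the only
-- freedom left is to rescale v and w inversely, and a coordinate 1 in v removes it. If x ≡ y mod p,
-- then x - y is a multiple of p and A sees E only modulo p^k; this is why B lives over the smaller
-- ring. Conversely every E over S lifts, because chart parameters are subject to no equation.
-- Dividing the recurrence by p^(k+1) leaves the increment p(p² - 1)/2 · p^(3k), hence a geometric
-- sum of ratio p³.

-- Integer coefficients let the solver cancel terms although equality in R is
-- not decidable.
module IntegerCoefficients {c ℓ : Level} (R : CommutativeRing c ℓ) where
  open CommutativeRing R renaming (refl to ≈-refl; sym to ≈-sym; trans to ≈-trans)
  open RingProperties ring using (-‿distribˡ-*; -‿distribʳ-*)
  open AbelianGroupProperties +-abelianGroup
    using () renaming (⁻¹-∙-comm to -‿+-comm; ⁻¹-involutive to -‿involutive; ε⁻¹≈ε to -0≈0)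
  open Mult semiring using (1+×; ×-homo-+; ×1-homo-*) renaming (_×_ to _×′_)
  open SetoidReasoning setoid

  private
    ⟦_⟧ : ℤ → Carrier
    ⟦ + n      ⟧ = n ×′ 1#
    ⟦ -[1+ n ] ⟧ = - (suc n ×′ 1#)

    cancel-1 : ∀ x y → (1# + x) - (1# + y) ≈ x - y
    cancel-1 x y = begin
      (1# + x) - (1# + y)       ≈⟨ +-cong (+-comm 1# x) (≈-sym (-‿+-comm 1# y)) ⟩
      (x + 1#) + (- 1# - y)     ≈⟨ +-assoc x 1# _ ⟩
      x + (1# + (- 1# - y))     ≈⟨ +-congˡ (≈-sym (+-assoc 1# (- 1#) (- y))) ⟩
      x + ((1# - 1#) - y)       ≈⟨ +-congˡ (+-congʳ (-‿inverseʳ 1#)) ⟩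
      x + (0# - y)              ≈⟨ +-congˡ (+-identityˡ (- y)) ⟩
      x - y                     ∎

    ⊖-homo : ∀ m n → ⟦ m ℤ.⊖ n ⟧ ≈ m ×′ 1# - n ×′ 1#
    ⊖-homo m       zero    = ≈-sym (≈-trans (+-congˡ -0≈0) (+-identityʳ _))
    ⊖-homo zero    (suc n) = ≈-sym (+-identityˡ _)
    ⊖-homo (suc m) (suc n) = begin
      ⟦ suc m ℤ.⊖ suc n ⟧             ≡⟨ ≡.cong ⟦_⟧ (ℤ.[1+m]⊖[1+n]≡m⊖n m n) ⟩
      ⟦ m ℤ.⊖ n ⟧                     ≈⟨ ⊖-homo m n ⟩
      m ×′ 1# - n ×′ 1#                 ≈⟨ cancel-1 _ _ ⟨
      (1# + m ×′ 1#) - (1# + n ×′ 1#)   ≈⟨ +-cong (1+× m 1#) (-‿cong (1+× n 1#)) ⟨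
      suc m ×′ 1# - suc n ×′ 1#         ∎

    -‿homo : ∀ i → ⟦ ℤ.- i ⟧ ≈ - ⟦ i ⟧
    -‿homo (+ zero)  = ≈-sym -0≈0
    -‿homo (+ suc n) = ≈-refl
    -‿homo -[1+ n ]  = ≈-sym (-‿involutive _)

    +-homo : ∀ i j → ⟦ i ℤ.+ j ⟧ ≈ ⟦ i ⟧ + ⟦ j ⟧
    +-homo (+ m)    (+ n)    = ×-homo-+ 1# m n
    +-homo (+ m)    -[1+ n ] = ⊖-homo m (suc n)
    +-homo -[1+ m ] (+ n)    = ≈-trans (⊖-homo n (suc m)) (+-comm _ _)
    +-homo -[1+ m ] -[1+ n ] = begin
      ⟦ -[1+ m ] ℤ.+ -[1+ n ] ⟧             ≡⟨ ≡.cong ⟦_⟧ (ℤ.neg-distrib-+ (+ suc m) (+ suc n)) ⟨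
      - ((suc m ℕ.+ suc n) ×′ 1#)            ≈⟨ -‿cong (×-homo-+ 1# (suc m) (suc n)) ⟩
      - (suc m ×′ 1# + suc n ×′ 1#)           ≈⟨ -‿+-comm _ _ ⟨
      - (suc m ×′ 1#) - suc n ×′ 1#           ∎

    *-homo-+ : ∀ i n → ⟦ i ℤ.* + n ⟧ ≈ ⟦ i ⟧ * ⟦ + n ⟧
    *-homo-+ (+ m)    n = ≈-trans (reflexive (≡.cong ⟦_⟧ (≡.sym (ℤ.pos-* m n)))) (×1-homo-* m n)
    *-homo-+ -[1+ m ] n = begin
      ⟦ -[1+ m ] ℤ.* + n ⟧            ≡⟨ ≡.cong ⟦_⟧ (ℤ.neg-distribˡ-* (+ suc m) (+ n)) ⟨
      ⟦ ℤ.- (+ suc m ℤ.* + n) ⟧       ≈⟨ -‿homo (+ suc m ℤ.* + n) ⟩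
      - ⟦ + suc m ℤ.* + n ⟧           ≈⟨ -‿cong (*-homo-+ (+ suc m) n) ⟩
      - (suc m ×′ 1# * ⟦ + n ⟧)        ≈⟨ -‿distribˡ-* _ _ ⟩
      - (suc m ×′ 1#) * ⟦ + n ⟧        ∎

    *-homo : ∀ i j → ⟦ i ℤ.* j ⟧ ≈ ⟦ i ⟧ * ⟦ j ⟧
    *-homo i (+ n)    = *-homo-+ i n
    *-homo i -[1+ n ] = begin
      ⟦ i ℤ.* -[1+ n ] ⟧        ≡⟨ ≡.cong ⟦_⟧ (ℤ.neg-distribʳ-* i (+ suc n)) ⟨
      ⟦ ℤ.- (i ℤ.* + suc n) ⟧   ≈⟨ -‿homo (i ℤ.* + suc n) ⟩
      - ⟦ i ℤ.* + suc n ⟧       ≈⟨ -‿cong (*-homo-+ i (suc n)) ⟩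
      - (⟦ i ⟧ * suc n ×′ 1#)    ≈⟨ -‿distribʳ-* _ _ ⟩
      ⟦ i ⟧ * - (suc n ×′ 1#)    ∎

    homomorphism : ℤ.+-*-rawRing -Raw-AlmostCommutative⟶ fromCommutativeRing R
    homomorphism = record
      { ⟦_⟧ = ⟦_⟧ ; +-homo = +-homo ; *-homo = *-homo ; -‿homo = -‿homo
      ; 0-homo = ≈-refl ; 1-homo = ≈-refl }

    _coeff≟_ : ∀ i j → Maybe (⟦ i ⟧ ≈ ⟦ j ⟧)
    i coeff≟ j = Maybe.map (λ eq → reflexive (≡.cong ⟦_⟧ eq)) (dec⇒maybe (i ℤ.≟ j))

  open RingSolver ℤ.+-*-rawRing (fromCommutativeRing R) homomorphism _coeff≟_ public
    using (solve; _:=_; _:+_; _:*_; :-_; _:-_; con)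


-- Pencils and rank-one idempotents over a commutative ring

record M₂ (F : Set) : Set where
  constructor mat
  field m₁₁ m₁₂ m₂₁ m₂₂ : F

open M₂

mat-cong : ∀ {F : Set} {a a′ b b′ c c′ d d′ : F} →
           a ≡ a′ → b ≡ b′ → c ≡ c′ → d ≡ d′ → mat a b c d ≡ mat a′ b′ c′ d′
mat-cong refl refl refl refl = refl

-- A point (β , γ) describes an idempotent: γ locates its image on the projective line, β its
-- kernel. The argument `G` is the range of γ in the second chart, so that this range can be cut
-- down to pR.
Chart : Set → Set → Set
Chart F G = (F × F) ⊎ (F × G)

module Spectral {F : Set} {add mul : Op₂ F} {neg : Op₁ F} {0F 1F : F}
  (isCommutativeRing : IsCommutativeRing _≡_ add mul neg 0F 1F) where

  commutativeRing : CommutativeRing 0ℓ 0ℓ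
  commutativeRing = record { isCommutativeRing = isCommutativeRing }

  open CommutativeRing commutativeRing
    using (_+_; _*_; -_; _-_; 0#; 1#; +-group; *-comm; *-identityˡ; *-identityʳ)
  open GroupProperties +-group public
    using () renaming (∙-cancelˡ to +-cancelˡ; ∙-cancelʳ to +-cancelʳ; x∙y⁻¹≈ε⇒x≈y to x-y≡0⇒x≡y)
  open IntegerCoefficients commutativeRing public
  open ≡-Reasoning

  IsUnit : F → Set
  IsUnit u = ∃[ u⁻¹ ] u * u⁻¹ ≡ 1#

  *-cancelˡ-unit : ∀ {u x y} → IsUnit u → u * x ≡ u * y → x ≡ y
  *-cancelˡ-unit {u} {x} {y} (e , ue≡1) eq = begin
    x              ≡⟨ expand x ⟩
    e * (u * x)    ≡⟨ cong (e *_) eq ⟩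
    e * (u * y)    ≡⟨ expand y ⟨
    y              ∎
    where
    expand : ∀ z → z ≡ e * (u * z)
    expand z = begin
      z              ≡⟨ *-identityˡ z ⟨
      1# * z         ≡⟨ cong (_* z) ue≡1 ⟨
      u * e * z      ≡⟨ solve 3 (λ u e z → u :* e :* z := e :* (u :* z)) refl u e z ⟩
      e * (u * z)    ∎

  dot : F × F → F × F → F
  dot (w₁ , w₂) (v₁ , v₂) = w₁ * v₁ + w₂ * v₂

  outer : F × F → F × F → M₂ F
  outer (v₁ , v₂) (w₁ , w₂) = mat (v₁ * w₁) (v₁ * w₂) (v₂ * w₁) (v₂ * w₂)

  -- x E + y (1 − E): when E is idempotent of rank one, x and y are the eigenvalues.
  pencil : F → F → M₂ F → M₂ F
  pencil x y (mat a b c d) =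
    mat (y + (x - y) * a) ((x - y) * b) ((x - y) * c) (y + (x - y) * d)

  -- For a fixed column v the rows with w·v = 1 form an affine line, and β is the parameter on it:
  -- (1 , 0) + β(γ , -1) in the first chart, (0 , 1) + β(1 , -γ) in the second.
  column row : Chart F F → F × F
  column (inj₁ (β , γ)) = 1# , γ
  column (inj₂ (β , γ)) = γ , 1#
  row (inj₁ (β , γ)) = 1# + β * γ , - β
  row (inj₂ (β , γ)) = β , 1# - β * γ

  projection : Chart F F → M₂ F
  projection f = outer (column f) (row f)

  -- Stated with charts instead of vectors satisfying w·v = 1: chart coordinates can be reduced and
  -- lifted between rings independently, with no equation to preserve.
  IsSpectral : M₂ F → Set
  IsSpectral A = ∃[ x ] ∃[ y ] ∃[ f ] A ≡ pencil x y (projection f)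

  dot-row-column : ∀ f → dot (row f) (column f) ≡ 1#
  dot-row-column (inj₁ (β , γ)) =
    solve 2 (λ β γ → (con (+ 1) :+ β :* γ) :* con (+ 1) :+ (:- β) :* γ := con (+ 1)) refl β γ
  dot-row-column (inj₂ (β , γ)) =
    solve 2 (λ β γ → β :* γ :+ (con (+ 1) :- β :* γ) :* con (+ 1) := con (+ 1)) refl β γ

  -- `discriminant` is trace² - 4 det, arranged so that each summand has a factor which visibly lies
  -- in pR when the matrix is of the form a + pB.
  trace det discriminant : M₂ F → F
  trace (mat a b c d) = a + d
  det (mat a b c d) = a * d - b * c
  discriminant (mat a b c d) = (a - d) * (a - d) + (b + b) * (c + c)

  module _ (x y : F) (v w : F × F) (w·v≡1 : dot w v ≡ 1#) where
    private
      v₁ = proj₁ v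
      v₂ = proj₂ v
      w₁ = proj₁ w
      w₂ = proj₂ w

    -- An outer product has trace `dot w v` and determinant zero. The solver cannot use `w·v≡1`, so
    -- this proof and the next two first isolate `dot w v` and then replace it by 1.
    trace-pencil : trace (pencil x y (outer v w)) ≡ y + x
    trace-pencil = begin
      trace (pencil x y (outer v w))    ≡⟨ solve 6 (λ x y v₁ v₂ w₁ w₂ →
          (y :+ (x :- y) :* (v₁ :* w₁)) :+ (y :+ (x :- y) :* (v₂ :* w₂))
          := y :+ (y :+ (x :- y) :* (w₁ :* v₁ :+ w₂ :* v₂))) refl x y v₁ v₂ w₁ w₂ ⟩
      y + (y + (x - y) * dot w v)       ≡⟨ cong (λ u → y + (y + (x - y) * u)) w·v≡1 ⟩
      y + (y + (x - y) * 1#)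
        ≡⟨ solve 2 (λ x y → y :+ (y :+ (x :- y) :* con (+ 1)) := y :+ x) refl x y ⟩
      y + x                             ∎

    det-pencil : det (pencil x y (outer v w)) ≡ y * x
    det-pencil = begin
      det (pencil x y (outer v w))      ≡⟨ solve 6 (λ x y v₁ v₂ w₁ w₂ →
          (y :+ (x :- y) :* (v₁ :* w₁)) :* (y :+ (x :- y) :* (v₂ :* w₂))
            :- ((x :- y) :* (v₁ :* w₂)) :* ((x :- y) :* (v₂ :* w₁))
          := y :* (y :+ (x :- y) :* (w₁ :* v₁ :+ w₂ :* v₂))) refl x y v₁ v₂ w₁ w₂ ⟩
      y * (y + (x - y) * dot w v)       ≡⟨ cong (λ u → y * (y + (x - y) * u)) w·v≡1 ⟩
      y * (y + (x - y) * 1#)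
        ≡⟨ solve 2 (λ x y → y :* (y :+ (x :- y) :* con (+ 1)) := y :* x) refl x y ⟩
      y * x                             ∎

    discriminant-pencil : discriminant (pencil x y (outer v w)) ≡ (x - y) * (x - y)
    discriminant-pencil = begin
      discriminant (pencil x y (outer v w))             ≡⟨ solve 6 (λ x y v₁ v₂ w₁ w₂ →
          let a = y :+ (x :- y) :* (v₁ :* w₁)
              b = (x :- y) :* (v₁ :* w₂)
              c = (x :- y) :* (v₂ :* w₁)
              d = y :+ (x :- y) :* (v₂ :* w₂)
          in (a :- d) :* (a :- d) :+ (b :+ b) :* (c :+ c)
             := ((x :- y) :* (w₁ :* v₁ :+ w₂ :* v₂)) :* ((x :- y) :* (w₁ :* v₁ :+ w₂ :* v₂)))
          refl x y v₁ v₂ w₁ w₂ ⟩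
      ((x - y) * dot w v) * ((x - y) * dot w v)
        ≡⟨ cong (λ u → ((x - y) * u) * ((x - y) * u)) w·v≡1 ⟩
      ((x - y) * 1#) * ((x - y) * 1#)
        ≡⟨ cong₂ _*_ (*-identityʳ _) (*-identityʳ _) ⟩
      (x - y) * (x - y)                                 ∎

    -- The matrix with columns v and (-w₂ , w₁) has determinant w·v = 1, and its inverse has rows w
    -- and (-v₂ , v₁). Hence 1 - v wᵀ is the outer product of the second column and second row, and
    -- it belongs to the other eigenvalue.
    complementary : pencil x y (outer v w) ≡ pencil y x (outer (- w₂ , w₁) (- v₂ , v₁))
    complementary = mat-cong
      (begin
        y + (x - y) * (v₁ * w₁)
          ≡⟨ solve 4 (λ x y a b →
                y :+ (x :- y) :* a
                := y :+ (x :- y) :* ((a :+ b) :- b)) refl x y (v₁ * w₁) (w₂ * v₂) ⟩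
        y + (x - y) * ((v₁ * w₁ + w₂ * v₂) - w₂ * v₂)
          ≡⟨ cong (λ u → y + (x - y) * (u - w₂ * v₂)) v₁w₁+w₂v₂≡1 ⟩
        y + (x - y) * (1# - w₂ * v₂)
          ≡⟨ solve 4 (λ x y w₂ v₂ →
                y :+ (x :- y) :* (con (+ 1) :- w₂ :* v₂)
                := x :+ (y :- x) :* ((:- w₂) :* (:- v₂))) refl x y w₂ v₂ ⟩
        x + (y - x) * (- w₂ * - v₂) ∎)
      (solve 4 (λ x y v₁ w₂ → (x :- y) :* (v₁ :* w₂) := (y :- x) :* ((:- w₂) :* v₁)) refl x y v₁ w₂)
      (solve 4 (λ x y v₂ w₁ → (x :- y) :* (v₂ :* w₁) := (y :- x) :* (w₁ :* (:- v₂))) refl x y v₂ w₁)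
      (begin
        y + (x - y) * (v₂ * w₂)
          ≡⟨ solve 4 (λ x y a b →
                y :+ (x :- y) :* b
                := y :+ (x :- y) :* ((a :+ b) :- a)) refl x y (w₁ * v₁) (v₂ * w₂) ⟩
        y + (x - y) * ((w₁ * v₁ + v₂ * w₂) - w₁ * v₁)
          ≡⟨ cong (λ u → y + (x - y) * (u - w₁ * v₁)) w₁v₁+v₂w₂≡1 ⟩
        y + (x - y) * (1# - w₁ * v₁)
          ≡⟨ solve 4 (λ x y w₁ v₁ →
                y :+ (x :- y) :* (con (+ 1) :- w₁ :* v₁)
                := x :+ (y :- x) :* (w₁ :* v₁)) refl x y w₁ v₁ ⟩
        x + (y - x) * (w₁ * v₁) ∎)
      where
      v₁w₁+w₂v₂≡1 : v₁ * w₁ + w₂ * v₂ ≡ 1#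
      v₁w₁+w₂v₂≡1 = trans (cong (_+ w₂ * v₂) (*-comm v₁ w₁)) w·v≡1
      w₁v₁+v₂w₂≡1 : w₁ * v₁ + v₂ * w₂ ≡ 1#
      w₁v₁+v₂w₂≡1 = trans (cong (_+_ (w₁ * v₁)) (*-comm v₂ w₂)) w·v≡1

    dot-complementary : dot (- v₂ , v₁) (- w₂ , w₁) ≡ 1#
    dot-complementary = trans
      (solve 4 (λ v₁ v₂ w₁ w₂ →
            (:- v₂) :* (:- w₂) :+ v₁ :* w₁ := w₁ :* v₁ :+ w₂ :* v₂) refl v₁ v₂ w₁ w₂)
      w·v≡1

  -- Both pairs are roots of the same monic quadratic, which factors as (X - x′)(X - y′); evaluate
  -- it at its root x.
  common-root : ∀ {x y x′ y′} → y + x ≡ y′ + x′ → y * x ≡ y′ * x′ → (x - x′) * (x - y′) ≡ 0#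
  common-root {x} {y} {x′} {y′} sum-eq product-eq = begin
    (x - x′) * (x - y′)
      ≡⟨ solve 3 (λ x x′ y′ →
            (x :- x′) :* (x :- y′) := x :* x :- x :* (y′ :+ x′) :+ y′ :* x′) refl x x′ y′ ⟩
    x * x - x * (y′ + x′) + y′ * x′     ≡⟨ cong₂ (λ s t → x * x - x * s + t) sum-eq product-eq ⟨
    x * x - x * (y + x) + y * x
      ≡⟨ solve 2 (λ x y → x :* x :- x :* (y :+ x) :+ y :* x := con (+ 0)) refl x y ⟩
    0#                                  ∎

  pencil-injective : ∀ {x y E E′} → IsUnit (x - y) → pencil x y E ≡ pencil x y E′ → E ≡ E′
  pencil-injective {x} {y} unit eq = mat-cong
    (*-cancelˡ-unit unit (+-cancelˡ y _ _ (cong m₁₁ eq)))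
    (*-cancelˡ-unit unit (cong m₁₂ eq))
    (*-cancelˡ-unit unit (cong m₂₁ eq))
    (*-cancelˡ-unit unit (+-cancelˡ y _ _ (cong m₂₂ eq)))

  module _ {v w v′ w′ : F × F} (w′·v′≡1 : dot w′ v′ ≡ 1#) (eq : outer v w ≡ outer v′ w′) where
    private
      v₁ = proj₁ v
      v₂ = proj₂ v
      w₁ = proj₁ w
      w₂ = proj₂ w
      v₁′ = proj₁ v′
      v₂′ = proj₂ v′
      w₁′ = proj₁ w′
      w₂′ = proj₂ w′

      -- v′ is fixed by v′w′ᵀ = vwᵀ.
      fixed : ∀ {a a′} → a * w₁ ≡ a′ * w₁′ → a * w₂ ≡ a′ * w₂′ → a′ ≡ a * dot w v′
      fixed {a} {a′} eq₁ eq₂ = begin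
        a′                                  ≡⟨ *-identityʳ a′ ⟨
        a′ * 1#                             ≡⟨ cong (a′ *_) w′·v′≡1 ⟨
        a′ * dot w′ v′                      ≡⟨ distribute a′ w₁′ w₂′ ⟩
        a′ * w₁′ * v₁′ + a′ * w₂′ * v₂′     ≡⟨ cong₂ (λ s t → s * v₁′ + t * v₂′) eq₁ eq₂ ⟨
        a * w₁ * v₁′ + a * w₂ * v₂′         ≡⟨ distribute a w₁ w₂ ⟨
        a * dot w v′                        ∎
        where
        distribute : ∀ a b c → a * (b * v₁′ + c * v₂′) ≡ a * b * v₁′ + a * c * v₂′
        distribute a b c = solve 5 (λ a b c v₁′ v₂′ →
          a :* (b :* v₁′ :+ c :* v₂′) := a :* b :* v₁′ :+ a :* c :* v₂′) refl a b c v₁′ v₂′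

    column-multiple₁ : v₁′ ≡ v₁ * dot w v′
    column-multiple₁ = fixed (cong m₁₁ eq) (cong m₁₂ eq)

    column-multiple₂ : v₂′ ≡ v₂ * dot w v′
    column-multiple₂ = fixed (cong m₂₁ eq) (cong m₂₂ eq)

  -- The columns of equal idempotents span the same line; the coordinate 1 that both contain forces
  -- the factor of proportionality `c` to be 1.
  same-column : ∀ {c γ γ′} → 1# ≡ 1# * c → γ′ ≡ γ * c → γ ≡ γ′
  same-column {c} {γ} {γ′} 1≡1c γ′≡γc = begin
    γ         ≡⟨ *-identityʳ γ ⟨
    γ * 1#    ≡⟨ cong (γ *_) (trans 1≡1c (*-identityˡ c)) ⟩
    γ * c     ≡⟨ γ′≡γc ⟨
    γ′        ∎

  projection-injective₁ : ∀ β γ β′ γ′ → projection (inj₁ (β , γ)) ≡ projection (inj₁ (β′ , γ′)) →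
                          β ≡ β′ × γ ≡ γ′
  projection-injective₁ β γ β′ γ′ eq =
    -‿injective (trans (sym (*-identityˡ _)) (trans (cong m₁₂ eq) (*-identityˡ _))) ,
    same-column (column-multiple₁ w′·v′≡1 eq) (column-multiple₂ w′·v′≡1 eq)
    where
    open GroupProperties +-group using () renaming (⁻¹-injective to -‿injective)
    w′·v′≡1 = dot-row-column (inj₁ (β′ , γ′))

  projection-injective₂ : ∀ β γ β′ γ′ → projection (inj₂ (β , γ)) ≡ projection (inj₂ (β′ , γ′)) →
                          β ≡ β′ × γ ≡ γ′
  projection-injective₂ β γ β′ γ′ eq =
    trans (sym (*-identityˡ _)) (trans (cong m₂₁ eq) (*-identityˡ _)) ,
    same-column (column-multiple₂ w′·v′≡1 eq) (column-multiple₁ w′·v′≡1 eq)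
    where w′·v′≡1 = dot-row-column (inj₂ (β′ , γ′))

  -- Proportionality of (γ , 1) and (1 , γ′) exhibits 1 as a multiple of γ. This decides how far the
  -- second chart must shrink to avoid the first.
  projection-overlap : ∀ β γ β′ γ′ → projection (inj₂ (β , γ)) ≡ projection (inj₁ (β′ , γ′)) →
                       IsUnit γ
  projection-overlap _ _ β′ γ′ eq =
    _ , sym (column-multiple₁ (dot-row-column (inj₁ (β′ , γ′))) eq)

  -- An outer product is unchanged when the column is multiplied by `s` and the row by its inverse
  -- `a`; this is that fact for one entry.
  rescale : ∀ {s a b c u} → a * s ≡ 1# → u ≡ a * b → c * b ≡ c * s * u
  rescale {s} {a} {b} {c} {u} as≡1 u≡ab = begin
    c * b               ≡⟨ cong (c *_) (*-identityˡ b) ⟨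
    c * (1# * b)        ≡⟨ cong (λ t → c * (t * b)) as≡1 ⟨
    c * (a * s * b)
      ≡⟨ solve 4 (λ a b c s → c :* (a :* s :* b) := c :* s :* (a :* b)) refl a b c s ⟩
    c * s * (a * b)     ≡⟨ cong (_*_ (c * s)) u≡ab ⟨
    c * s * u           ∎

  module _ {v w : F × F} (w·v≡1 : dot w v ≡ 1#) {s : F} where
    private
      v₁ = proj₁ v
      v₂ = proj₂ v
      w₁ = proj₁ w
      w₂ = proj₂ w

    -- Rescaling by s = v₁⁻¹ turns the column into (1 , v₂s) and the row into v₁w, whose second
    -- coordinate is -β.
    chart₁ : v₁ * s ≡ 1# → outer v w ≡ projection (inj₁ (- (w₂ * v₁) , v₂ * s))
    chart₁ v₁s≡1 = mat-cong
      (trans (sym row₁) (sym (*-identityˡ _)))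
      (trans (sym row₂) (sym (*-identityˡ _)))
      (rescale v₁s≡1 row₁)
      (rescale v₁s≡1 row₂)
      where
      row₁ : 1# + - (w₂ * v₁) * (v₂ * s) ≡ v₁ * w₁
      row₁ = begin
        1# + - (w₂ * v₁) * (v₂ * s)
          ≡⟨ solve 4 (λ v₁ v₂ w₂ s →
                con (+ 1) :+ (:- (w₂ :* v₁)) :* (v₂ :* s)
                := con (+ 1) :- (w₂ :* v₂) :* (v₁ :* s)) refl v₁ v₂ w₂ s ⟩
        1# - (w₂ * v₂) * (v₁ * s)
          ≡⟨ cong₂ (λ t u → t - (w₂ * v₂) * u) (sym w·v≡1) v₁s≡1 ⟩
        (w₁ * v₁ + w₂ * v₂) - (w₂ * v₂) * 1#
          ≡⟨ solve 4 (λ v₁ v₂ w₁ w₂ →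
                (w₁ :* v₁ :+ w₂ :* v₂) :- (w₂ :* v₂) :* con (+ 1) := v₁ :* w₁) refl v₁ v₂ w₁ w₂ ⟩
        v₁ * w₁                                       ∎
      row₂ : - - (w₂ * v₁) ≡ v₁ * w₂
      row₂ = solve 2 (λ v₁ w₂ → :- (:- (w₂ :* v₁)) := v₁ :* w₂) refl v₁ w₂

    chart₂ : v₂ * s ≡ 1# → outer v w ≡ projection (inj₂ (w₁ * v₂ , v₁ * s))
    chart₂ v₂s≡1 = mat-cong
      (rescale v₂s≡1 row₁)
      (rescale v₂s≡1 row₂)
      (trans (sym row₁) (sym (*-identityˡ _)))
      (trans (sym row₂) (sym (*-identityˡ _)))
      where
      row₁ : w₁ * v₂ ≡ v₂ * w₁
      row₁ = *-comm w₁ v₂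
      row₂ : 1# - (w₁ * v₂) * (v₁ * s) ≡ v₂ * w₂
      row₂ = begin
        1# - (w₁ * v₂) * (v₁ * s)
          ≡⟨ solve 4 (λ v₁ v₂ w₁ s →
                con (+ 1) :- (w₁ :* v₂) :* (v₁ :* s)
                := con (+ 1) :- (w₁ :* v₁) :* (v₂ :* s)) refl v₁ v₂ w₁ s ⟩
        1# - (w₁ * v₁) * (v₂ * s)
          ≡⟨ cong₂ (λ t u → t - (w₁ * v₁) * u) (sym w·v≡1) v₂s≡1 ⟩
        (w₁ * v₁ + w₂ * v₂) - (w₁ * v₁) * 1#
          ≡⟨ solve 4 (λ v₁ v₂ w₁ w₂ →
                (w₁ :* v₁ :+ w₂ :* v₂) :- (w₁ :* v₁) :* con (+ 1) := v₂ :* w₂) refl v₁ v₂ w₁ w₂ ⟩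
        v₂ * w₂                                       ∎

-- A bijection of `T` with the elements satisfying `P`, phrased without a subtype so that different
-- proofs of `P` do not count as different elements.
record _Enumerates_ (T : Set) {X : Set} (P : X → Set) : Set where
  field
    element   : T → X
    sound     : ∀ t → P (element t)
    injective : Injective _≡_ _≡_ element
    complete  : ∀ {x} → P x → ∃[ t ] element t ≡ x

-- The induction step over a local ring with digit expansions

DecreasingPair : ℕ → Set
DecreasingPair p = Σ[ (a , b) ∈ Fin p × Fin p ] b Fin.< a

-- R = ℤ/p^(k+1) over S = ℤ/p^k: φ is multiplication by p, π is reduction and
-- τ a is the representative of the residue a modulo p.
module BaseP
  {F : Set} {add mul : Op₂ F} {neg : Op₁ F} {0F 1F : F}
  (R : IsCommutativeRing _≡_ add mul neg 0F 1F)
  {G : Set} {addS mulS : Op₂ G} {negS : Op₁ G} {0G 1G : G}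
  (S : IsCommutativeRing _≡_ addS mulS negS 0G 1G)
  (p : ℕ) where

  private
    module R = Spectral R
    module S = Spectral S
    module S′ = CommutativeRing S.commutativeRing
  open CommutativeRing R.commutativeRing hiding (refl; sym; trans)
  open R using (solve; _:=_; _:+_; _:*_; :-_; _:-_; con; IsUnit)
  open ≡-Reasoning

  -- All that the step uses of the two rings beyond their axioms. `φ-*` makes `φ` linear when R acts
  -- on S through `π`; `φ⊎unit` and `φ≢1` say that the image of `φ` consists exactly of the
  -- non-units.
  record Expansion : Set where
    field
      τ : Fin p → F
      φ : G → F
      π : F → G
      digits           : ∀ r → ∃₂ λ a s → r ≡ τ a + φ s
      digits-injective : ∀ {a a′ s s′} → τ a + φ s ≡ τ a′ + φ s′ → a ≡ a′ × s ≡ s′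
      φ-+          : ∀ s t → φ (s S′.+ t) ≡ φ s + φ t
      φ-*          : ∀ r s → r * φ s ≡ φ (π r S′.* s)
      π-+          : ∀ r r′ → π (r + r′) ≡ π r S′.+ π r′
      π-*          : ∀ r r′ → π (r * r′) ≡ π r S′.* π r′
      π-1          : π 1# ≡ S′.1#
      π-surjective : ∀ s → ∃[ r ] π r ≡ s
      φ⊎unit       : ∀ r → (∃[ s ] φ s ≡ r) ⊎ IsUnit r
      φ≢1          : ∀ s → φ s ≢ 1#

  module Step (expansion : Expansion) where
    open Expansion expansion

    φ-0 : φ S′.0# ≡ 0#
    φ-0 = RingProperties.x+x≈x⇒x≈0 ring (φ S′.0#)
      (trans (sym (φ-+ _ _)) (cong φ (S′.+-identityˡ _)))

    π-0 : π 0# ≡ S′.0#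
    π-0 = RingProperties.x+x≈x⇒x≈0 S′.ring (π 0#)
      (trans (sym (π-+ _ _)) (cong π (+-identityˡ _)))

    φ-neg : ∀ s → φ (S′.- s) ≡ - φ s
    φ-neg s = GroupProperties.inverseˡ-unique +-group _ _
      (trans (sym (φ-+ _ _)) (trans (cong φ (S′.-‿inverseˡ s)) φ-0))

    φ-sub : ∀ s t → φ (s S′.- t) ≡ φ s - φ t
    φ-sub s t = trans (φ-+ s (S′.- t)) (cong (_+_ (φ s)) (φ-neg t))

    π-neg : ∀ r → π (- r) ≡ S′.- π r
    π-neg r = GroupProperties.inverseˡ-unique S′.+-group _ _
      (trans (sym (π-+ _ _)) (trans (cong π (-‿inverseˡ r)) π-0))

    φ-injective : ∀ {s t} → φ s ≡ φ t → s ≡ t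
    φ-injective {s} {t} φs≡φt = proj₂ (digits-injective (cong (_+_ (τ a)) φs≡φt))
      -- Here `p` is arbitrary, so `Fin p` is not known to be inhabited; expanding zero supplies a
      -- digit.
      where a = proj₁ (digits 0#)

    InIdeal : F → Set
    InIdeal r = ∃[ s ] φ s ≡ r

    ideal-+ : ∀ {x y} → InIdeal x → InIdeal y → InIdeal (x + y)
    ideal-+ (s , refl) (t , refl) = _ , φ-+ s t

    ideal-* : ∀ r {x} → InIdeal x → InIdeal (r * x)
    ideal-* r (s , refl) = _ , sym (φ-* r s)

    ideal-no-unit : ∀ {u} → InIdeal u → IsUnit u → ⊥
    ideal-no-unit {u} i (u⁻¹ , uu⁻¹≡1) =
      let s , eq = ideal-* u⁻¹ i in φ≢1 s (trans eq (trans (*-comm u⁻¹ u) uu⁻¹≡1))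

    digit : Fin p → G → F
    digit a s = τ a + φ s

    -- Adding an element of the ideal alters only the S-digit, and the expansion is unique.
    ideal-digits : ∀ {a b s t} → InIdeal (digit a s - digit b t) → a ≡ b
    ideal-digits {a} {b} {s} {t} (u , φu≡) = proj₁ (digits-injective (begin
      digit a s
        ≡⟨ solve 2 (λ x y → x := y :+ (x :- y)) refl (digit a s) (digit b t) ⟩
      digit b t + (digit a s - digit b t)   ≡⟨ cong (_+_ (digit b t)) φu≡ ⟨
      τ b + φ t + φ u                   ≡⟨ +-assoc (τ b) (φ t) (φ u) ⟩
      τ b + (φ t + φ u)                 ≡⟨ cong (_+_ (τ b)) (φ-+ t u) ⟨
      digit b (t S′.+ u)                ∎))

    unit-digits : ∀ {a b s t} → a ≢ b → IsUnit (digit a s - digit b t)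
    unit-digits {a} {b} {s} {t} a≢b with φ⊎unit (digit a s - digit b t)
    ... | inj₁ i = ⊥-elim (a≢b (ideal-digits i))
    ... | inj₂ u = u

    lift : Fin p → M₂ G → M₂ F
    lift a (mat m₁₁ m₁₂ m₂₁ m₂₂) = mat (digit a m₁₁) (φ m₁₂) (φ m₂₁) (digit a m₂₂)

    lift-injective : ∀ {a a′ A A′} → lift a A ≡ lift a′ A′ → a ≡ a′ × A ≡ A′
    lift-injective {a} eq with digits-injective (cong M₂.m₁₁ eq)
    ... | refl , eq₁₁ = refl , mat-cong eq₁₁ (φ-injective (cong M₂.m₁₂ eq)) (φ-injective (cong M₂.m₂₁ eq))
                                 (proj₂ (digits-injective (cong M₂.m₂₂ eq)))

    π₂ : F × F → G × G
    π₂ = map π π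

    π-chart : Chart F F → Chart G G
    π-chart = Sum.map π₂ π₂

    π-column : ∀ f → π₂ (R.column f) ≡ S.column (π-chart f)
    π-column (inj₁ (β , γ)) = cong (_, π γ) π-1
    π-column (inj₂ (β , γ)) = cong (π γ ,_) π-1

    π-row : ∀ f → π₂ (R.row f) ≡ S.row (π-chart f)
    π-row (inj₁ (β , γ)) = cong₂ _,_
      (trans (π-+ _ _) (cong₂ S′._+_ π-1 (π-* β γ)))
      (π-neg β)
    π-row (inj₂ (β , γ)) = cong (π β ,_)
      (trans (π-+ _ _) (cong₂ S′._+_ π-1 (trans (π-neg _) (cong S′.-_ (π-* β γ)))))

    π-chart-surjective : ∀ g → ∃[ f ] π-chart f ≡ g
    π-chart-surjective (inj₁ (β , γ)) =
      let β′ , eq = π-surjective β ; γ′ , eq′ = π-surjective γ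
      in inj₁ (β′ , γ′) , cong inj₁ (cong₂ _,_ eq eq′)
    π-chart-surjective (inj₂ (β , γ)) =
      let β′ , eq = π-surjective β ; γ′ , eq′ = π-surjective γ
      in inj₂ (β′ , γ′) , cong inj₂ (cong₂ _,_ eq eq′)

    module _ (a : Fin p) (x y : G) where
      private
        scaled : ∀ r r′ → φ ((x S′.- y) S′.* (π r S′.* π r′)) ≡ (digit a x - digit a y) * (r * r′)
        scaled r r′ = begin
          φ ((x S′.- y) S′.* (π r S′.* π r′))     ≡⟨ cong φ (S′.*-comm _ _) ⟩
          φ ((π r S′.* π r′) S′.* (x S′.- y))     ≡⟨ cong (λ u → φ (u S′.* (x S′.- y))) (π-* r r′) ⟨
          φ (π (r * r′) S′.* (x S′.- y))          ≡⟨ φ-* (r * r′) (x S′.- y) ⟨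
          (r * r′) * φ (x S′.- y)                 ≡⟨ cong (_*_ (r * r′)) (φ-sub x y) ⟩
          (r * r′) * (φ x - φ y)
            ≡⟨ solve 4 (λ u t x y →
                  u :* (x :- y) := ((t :+ x) :- (t :+ y)) :* u) refl (r * r′) (τ a) (φ x) (φ y) ⟩
          (digit a x - digit a y) * (r * r′)      ∎

        shifted : ∀ r r′ → digit a (y S′.+ (x S′.- y) S′.* (π r S′.* π r′))
                           ≡ digit a y + (digit a x - digit a y) * (r * r′)
        shifted r r′ = begin
          digit a (y S′.+ (x S′.- y) S′.* (π r S′.* π r′))      ≡⟨ cong (_+_ (τ a)) (φ-+ y _) ⟩
          τ a + (φ y + φ ((x S′.- y) S′.* (π r S′.* π r′)))     ≡⟨ +-assoc (τ a) (φ y) _ ⟨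
          digit a y + φ ((x S′.- y) S′.* (π r S′.* π r′))
            ≡⟨ cong (_+_ (digit a y)) (scaled r r′) ⟩
          digit a y + (digit a x - digit a y) * (r * r′)        ∎

        lift-pencil-outer : ∀ v w → lift a (S.pencil x y (S.outer (π₂ v) (π₂ w)))
                                    ≡ R.pencil (digit a x) (digit a y) (R.outer v w)
        lift-pencil-outer (v₁ , v₂) (w₁ , w₂) =
          mat-cong (shifted v₁ w₁) (scaled v₁ w₂) (scaled v₂ w₁) (shifted v₂ w₂)

      -- With a common digit `a` the eigenvalues differ by φ(x - y), and by `φ-*` multiplying such
      -- an element by an entry of E uses only the reduction of that entry. The identity serves
      -- twice: soundness lifts a chart from S, completeness reduces one from R.
      lift-pencil : ∀ f → lift a (S.pencil x y (S.projection (π-chart f)))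
                          ≡ R.pencil (digit a x) (digit a y) (R.projection f)
      lift-pencil f = begin
        lift a (S.pencil x y (S.projection (π-chart f)))                          ≡⟨ cong₂ (λ v w → lift a (S.pencil x y (S.outer v w))) (π-column f) (π-row f) ⟨
        lift a (S.pencil x y (S.outer (π₂ (R.column f)) (π₂ (R.row f))))
          ≡⟨ lift-pencil-outer (R.column f) (R.row f) ⟩
        R.pencil (digit a x) (digit a y) (R.projection f)                         ∎

    discriminant-lift : ∀ a A → InIdeal (R.discriminant (lift a A))
    discriminant-lift a (mat m₁₁ m₁₂ m₂₁ m₂₂) =
      ideal-+ (ideal-* _ (_ , difference)) (ideal-* _ (_ , φ-+ m₂₁ m₂₁))
      where
      difference : φ (m₁₁ S′.- m₂₂) ≡ digit a m₁₁ - digit a m₂₂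
      difference = trans (φ-sub m₁₁ m₂₂)
        (solve 3 (λ t x y → x :- y := (t :+ x) :- (t :+ y)) refl (τ a) (φ m₁₁) (φ m₂₂))

    -- The charts overlap; restricting γ to pR in the second one makes each
    -- projection occur once.
    include : Chart F G → Chart F F
    include = Sum.map₂ (map₂ φ)

    -- An idempotent in both charts would have γ a unit, whereas `include` places γ of the second
    -- chart in the ideal.
    projection-injective : ∀ f g → R.projection (include f) ≡ R.projection (include g) → f ≡ g
    projection-injective (inj₁ (β , γ)) (inj₁ (β′ , γ′)) eq =
      cong inj₁ (cong₂ _,_ (proj₁ equal) (proj₂ equal))
      where equal = R.projection-injective₁ β γ β′ γ′ eq
    projection-injective (inj₂ (β , s)) (inj₂ (β′ , s′)) eq =
      cong inj₂ (cong₂ _,_ (proj₁ equal) (φ-injective (proj₂ equal)))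
      where equal = R.projection-injective₂ β (φ s) β′ (φ s′) eq
    projection-injective (inj₁ (β , γ)) (inj₂ (β′ , s′)) eq =
      ⊥-elim (ideal-no-unit (s′ , refl) (R.projection-overlap β′ (φ s′) β γ (sym eq)))
    projection-injective (inj₂ (β , s)) (inj₁ (β′ , γ′)) eq =
      ⊥-elim (ideal-no-unit (s , refl) (R.projection-overlap β (φ s) β′ γ′ eq))

    -- If both coordinates of v were in the ideal, so would be w·v = 1; hence one of them is a unit
    -- and can be scaled to 1.
    normalise : ∀ v w → R.dot w v ≡ 1# → ∃[ f ] R.outer v w ≡ R.projection (include f)
    normalise (v₁ , v₂) (w₁ , w₂) w·v≡1 with φ⊎unit v₁
    ... | inj₂ (s , v₁s≡1) = inj₁ _ , R.chart₁ w·v≡1 v₁s≡1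
    ... | inj₁ i with φ⊎unit v₂
    ...   | inj₁ j = ⊥-elim (φ≢1 _ (trans (proj₂ (ideal-+ (ideal-* w₁ i) (ideal-* w₂ j))) w·v≡1))
    ...   | inj₂ (s , v₂s≡1) =
      -- v₁ is in the ideal in this branch, so γ = v₁s is too, as the restricted second chart
      -- requires.
      let t , φt≡sv₁ = ideal-* s i
          φt≡v₁s = trans φt≡sv₁ (*-comm s v₁)
      in inj₂ (w₁ * v₂ , t) ,
         trans (R.chart₂ w·v≡1 v₂s≡1) (cong (λ γ → R.projection (inj₂ (w₁ * v₂ , γ))) (sym φt≡v₁s))

    Regular : Set
    Regular = DecreasingPair p × (G × G) × Chart F G

    regular : Regular → M₂ F
    regular (((a , b) , _) , (s , t) , f) =
      R.pencil (digit a s) (digit b t) (R.projection (include f))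

    regular-≡ : ∀ {a a′ b b′ b<a b′<a′ s s′ t t′ f f′} → a ≡ a′ → b ≡ b′ → s ≡ s′ → t ≡ t′ → f ≡ f′ →
                _≡_ {A = Regular} (((a , b) , b<a) , (s , t) , f) (((a′ , b′) , b′<a′) , (s′ , t′) , f′)
    regular-≡ {a} {b = b} {s = s} {t = t} {f = f} refl refl refl refl refl =
      cong (λ lt → ((a , b) , lt) , (s , t) , f) (ℕ.<-irrelevant _ _)

    -- Of x - x′ and x - y′ at least one is a unit, since otherwise a′ and b′ would both equal the
    -- residue of x. Then `root` yields x = x′ or x = y′, and the latter swaps the eigenvalues
    -- against the order of their residues.
    regular-injective : ∀ r r′ → regular r ≡ regular r′ → r ≡ r′
    regular-injective (((a , b) , b<a) , (s , t) , f) (((a′ , b′) , b′<a′) , (s′ , t′) , f′) eq =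
      conclude (φ⊎unit (x - y′)) (φ⊎unit (x - x′))
      where
      x  = digit a s
      y  = digit b t
      x′ = digit a′ s′
      y′ = digit b′ t′
      E  = R.projection (include f)
      E′ = R.projection (include f′)

      sum-eq : y + x ≡ y′ + x′
      sum-eq = trans (sym (R.trace-pencil x y (R.column (include f)) (R.row (include f)) (R.dot-row-column (include f))))
        (trans (cong R.trace eq) (R.trace-pencil x′ y′ (R.column (include f′)) (R.row (include f′)) (R.dot-row-column (include f′))))

      product-eq : y * x ≡ y′ * x′
      product-eq = trans (sym (R.det-pencil x y (R.column (include f)) (R.row (include f)) (R.dot-row-column (include f))))
        (trans (cong R.det eq) (R.det-pencil x′ y′ (R.column (include f′)) (R.row (include f′)) (R.dot-row-column (include f′))))

      root : (x - x′) * (x - y′) ≡ 0#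
      root = R.common-root {x} {y} {x′} {y′} sum-eq product-eq

      unit-cancel : ∀ {u v} → IsUnit u → u * v ≡ 0# → v ≡ 0#
      unit-cancel {u} {v} unit uv≡0 = R.*-cancelˡ-unit {u} {v} {0#} unit (trans uv≡0 (sym (zeroʳ u)))

      Goal : Set
      Goal = _≡_ {A = Regular} (((a , b) , b<a) , (s , t) , f) (((a′ , b′) , b′<a′) , (s′ , t′) , f′)

      same-order : x ≡ x′ → Goal
      same-order x≡x′ = regular-≡
        (proj₁ (digits-injective x≡x′)) (proj₁ (digits-injective y≡y′))
        (proj₂ (digits-injective x≡x′)) (proj₂ (digits-injective y≡y′))
        (projection-injective f f′ (R.pencil-injective {x} {y} {E} {E′}
          (unit-digits (λ a≡b → Fin.<⇒≢ b<a (sym a≡b)))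
          (trans eq (cong₂ (λ u v → R.pencil u v E′) (sym x≡x′) (sym y≡y′)))))
        where
        y≡y′ : y ≡ y′
        y≡y′ = R.+-cancelʳ x y y′ (trans sum-eq (cong (_+_ y′) (sym x≡x′)))

      conclude : InIdeal (x - y′) ⊎ IsUnit (x - y′) → InIdeal (x - x′) ⊎ IsUnit (x - x′) → Goal
      conclude (inj₂ u) _ = same-order (R.x-y≡0⇒x≡y x x′ (unit-cancel u (trans (*-comm (x - y′) (x - x′)) root)))
      conclude (inj₁ i) (inj₁ j) = ⊥-elim (Fin.<⇒≢ b′<a′ (trans (sym (ideal-digits i)) (ideal-digits j)))
      conclude (inj₁ i) (inj₂ u) = ⊥-elim (Fin.<-asym b<a (≡.subst₂ Fin._<_ (sym a≡b′) (sym b≡a′) b′<a′))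
        where
        x≡y′ : x ≡ y′
        x≡y′ = R.x-y≡0⇒x≡y x y′ (unit-cancel u root)
        a≡b′ : a ≡ b′
        a≡b′ = proj₁ (digits-injective x≡y′)
        b≡a′ : b ≡ a′
        b≡a′ = proj₁ (digits-injective (R.+-cancelˡ x y x′
          (trans (+-comm x y) (trans sum-eq (cong (_+ x′) (sym x≡y′))))))

    enumerate : ∀ {T} → T Enumerates S.IsSpectral → ((Fin p × T) ⊎ Regular) Enumerates R.IsSpectral
    enumerate {T} E = record
      { element = element ; sound = sound ; injective = injective ; complete = complete }
      where
      module E = _Enumerates_ E

      element : (Fin p × T) ⊎ Regular → M₂ F
      element (inj₁ (a , t)) = lift a (E.element t)
      element (inj₂ r)       = regular r

      sound : ∀ t → R.IsSpectral (element t)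
      sound (inj₁ (a , t)) =
        let x , y , g , eq = E.sound t
            f , πf≡g = π-chart-surjective g
        in _ , _ , f , trans
             (cong (lift a) (trans eq (cong (λ h → S.pencil x y (S.projection h)) (sym πf≡g))))
             (lift-pencil a x y f)
      sound (inj₂ (_ , _ , f)) = _ , _ , include f , refl

      disjoint : ∀ {a A} r → lift a A ≡ regular r → ⊥
      disjoint {a} {A} (((b , c) , c<b) , (s , t) , f) eq = ideal-no-unit square-in-ideal (_ , square-unit)
        where
        u = unit-digits {s = s} {t} (λ b≡c → Fin.<⇒≢ c<b (sym b≡c))
        d = digit b s - digit c t

        square-in-ideal : InIdeal (d * d)
        square-in-ideal = ≡.subst InIdeal
          (trans (cong R.discriminant eq) (R.discriminant-pencil _ _ (R.column (include f)) (R.row (include f)) (R.dot-row-column (include f))))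
          (discriminant-lift a A)

        square-unit : d * d * (proj₁ u * proj₁ u) ≡ 1#
        square-unit = trans
          (solve 2 (λ d e → d :* d :* (e :* e) := (d :* e) :* (d :* e)) refl d (proj₁ u))
          (trans (cong₂ _*_ (proj₂ u) (proj₂ u)) (*-identityˡ 1#))

      injective : Injective _≡_ _≡_ element
      injective {inj₁ (a , t)} {inj₁ (a′ , t′)} eq with lift-injective {A = E.element t} {E.element t′} eq
      ... | refl , eq′ = cong (λ t → inj₁ (a , t)) (E.injective eq′)
      injective {inj₁ (a , t)} {inj₂ r} eq = ⊥-elim (disjoint {A = E.element t} r eq)
      injective {inj₂ r} {inj₁ (a , t)} eq = ⊥-elim (disjoint {A = E.element t} r (sym eq))
      injective {inj₂ r} {inj₂ r′}      eq = cong inj₂ (regular-injective r r′ eq)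

      cover : ∀ x y f → ∃[ t ] element t ≡ R.pencil x y (R.projection f)
      cover x y f with digits x | digits y
      ... | a , s , refl | b , t , refl with Fin.<-cmp a b
      ... | tri> _ _ b<a =
        let g , eq = normalise (R.column f) (R.row f) (R.dot-row-column f)
        in inj₂ (((a , b) , b<a) , (s , t) , g) , cong (R.pencil (digit a s) (digit b t)) (sym eq)
      -- The larger residue has to come first, so the eigenvalues are exchanged and E gives way to
      -- its complement.
      ... | tri< a<b _ _ =
        let g , eq = normalise _ _ (R.dot-complementary (digit a s) (digit b t) (R.column f) (R.row f) (R.dot-row-column f))
        in inj₂ (((b , a) , a<b) , (t , s) , g) ,
           trans (cong (R.pencil (digit b t) (digit a s)) (sym eq))
                 (sym (R.complementary (digit a s) (digit b t) (R.column f) (R.row f) (R.dot-row-column f)))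
      ... | tri≈ _ refl _ =
        let τ , eq = E.complete (s , t , π-chart f , refl)
        in inj₁ (a , τ) , trans (cong (lift a) eq) (lift-pencil a s t f)

      complete : ∀ {A} → R.IsSpectral A → ∃[ t ] element t ≡ A
      complete (x , y , f , refl) = cover x y f

-- Diagonalizability in terms of pencils

module Diagonalization {F : Set} {add mul : Op₂ F} {neg : Op₁ F} {0F 1F : F}
  (isCommutativeRing : IsCommutativeRing _≡_ add mul neg 0F 1F) where

  open Spectral isCommutativeRing
  open CommutativeRing commutativeRing
    using (_+_; _*_; -_; _-_; 0#; 1#; *-identityʳ; zeroʳ; +-identityˡ; +-identityʳ)
  open Matrices commutativeRing
  open ≡-Reasoning

  -- Entrywise equal functions need not be propositionally equal, so the counting is done on the
  -- record `M₂`, where `≡` is entrywise equality; `entries` and `matrix` translate.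
  entries : Matrix 2 → M₂ F
  entries A = mat (A zero zero) (A zero (suc zero)) (A (suc zero) zero) (A (suc zero) (suc zero))

  matrix : M₂ F → Matrix 2
  matrix (mat a b c d) zero       zero       = a
  matrix (mat a b c d) zero       (suc zero) = b
  matrix (mat a b c d) (suc zero) zero       = c
  matrix (mat a b c d) (suc zero) (suc zero) = d

  entries-cong : ∀ {A B} → A ≋ B → entries A ≡ entries B
  entries-cong A≋B = mat-cong (A≋B _ _) (A≋B _ _) (A≋B _ _) (A≋B _ _)

  entries-injective : ∀ {A B} → entries A ≡ entries B → A ≋ B
  entries-injective eq zero       zero       = cong M₂.m₁₁ eq
  entries-injective eq zero       (suc zero) = cong M₂.m₁₂ eq
  entries-injective eq (suc zero) zero       = cong M₂.m₂₁ eq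
  entries-injective eq (suc zero) (suc zero) = cong M₂.m₂₂ eq

  private
    -- One entry of P D P⁻¹ with `sum` unfolded, including its final `0#`. The entry δ of P P⁻¹
    -- eliminates the second idempotent through b d = δ - a c.
    conjugate-entry : ∀ a b x y c d {z z′ δ} → z ≡ 0# → z′ ≡ 0# → a * c + (b * d + 0#) ≡ δ →
      (a * x + (b * z + 0#)) * c + ((a * z′ + (b * y + 0#)) * d + 0#)
      ≡ y * δ + (x - y) * (a * c)
    conjugate-entry a b x y c d refl refl refl = solve 6 (λ a b x y c d →
      (a :* x :+ (b :* con (+ 0) :+ con (+ 0))) :* c :+
        ((a :* con (+ 0) :+ (b :* y :+ con (+ 0))) :* d :+ con (+ 0))
      := y :* (a :* c :+ (b :* d :+ con (+ 0))) :+ (x :- y) :* (a :* c)) refl a b x y c d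

    δ≡1 : ∀ y u → y * 1# + u ≡ y + u
    δ≡1 y u = cong (_+ u) (*-identityʳ y)

    δ≡0 : ∀ y u → y * 0# + u ≡ u
    δ≡0 y u = trans (cong (_+ u) (zeroʳ y)) (+-identityˡ u)

  -- Since D = y + (x - y) e₁e₁ᵀ, conjugation leaves only v, the first column of P, and w, the first
  -- row of P⁻¹.
  diagonalizable⇒pencil : ∀ {A : Matrix 2} → Diagonalizable A →
    ∃₂ λ x y → ∃₂ λ v w → dot w v ≡ 1# × entries A ≡ pencil x y (outer v w)
  diagonalizable⇒pencil {A} diagonalizable =
    D zero zero , D (suc zero) (suc zero) ,
    (P zero zero , P (suc zero) zero) , (P⁻¹ zero zero , P⁻¹ zero (suc zero)) ,
    trans (cong (_+_ (P⁻¹ zero zero * P zero zero)) (sym (+-identityʳ _))) (P⁻¹⊠P zero zero) ,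
    mat-cong
      (trans (entry zero zero) (δ≡1 _ _)) (trans (entry zero (suc zero)) (δ≡0 _ _))
      (trans (entry (suc zero) zero) (δ≡0 _ _)) (trans (entry (suc zero) (suc zero)) (δ≡1 _ _))
    where
    open Diagonalizable diagonalizable
    entry : ∀ i j → A i j ≡ D (suc zero) (suc zero) * identity i j
      + (D zero zero - D (suc zero) (suc zero)) * (P i zero * P⁻¹ zero j)
    entry i j = trans (A≋PDP⁻¹ i j)
      (conjugate-entry (P i zero) (P i (suc zero)) (D zero zero) (D (suc zero) (suc zero))
        (P⁻¹ zero j) (P⁻¹ (suc zero) j)
        (D-diagonal (suc zero) zero λ ()) (D-diagonal zero (suc zero) λ ()) (P⊠P⁻¹ i j))

  -- The column (-w₂ , w₁) completes v to a matrix of determinant w·v = 1, whose adjugate is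
  -- therefore its inverse.
  pencil⇒diagonalizable : ∀ x y v w → dot w v ≡ 1# →
    Diagonalizable (matrix (pencil x y (outer v w)))
  pencil⇒diagonalizable x y (v₁ , v₂) (w₁ , w₂) w·v≡1 = record
    { P = P ; P⁻¹ = P⁻¹ ; D = D
    ; P⊠P⁻¹ = P⊠P⁻¹
    ; P⁻¹⊠P = λ where
        zero       zero       → unit (solve 4 (λ v₁ v₂ w₁ w₂ →
              w₁ :* v₁ :+ (w₂ :* v₂ :+ con (+ 0)) := w₁ :* v₁ :+ w₂ :* v₂) refl v₁ v₂ w₁ w₂)
        zero       (suc zero) → solve 2 (λ w₁ w₂ →
              w₁ :* (:- w₂) :+ (w₂ :* w₁ :+ con (+ 0)) := con (+ 0)) refl w₁ w₂
        (suc zero) zero       → solve 2 (λ v₁ v₂ →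
              (:- v₂) :* v₁ :+ (v₁ :* v₂ :+ con (+ 0)) := con (+ 0)) refl v₁ v₂
        (suc zero) (suc zero) → unit (solve 4 (λ v₁ v₂ w₁ w₂ →
              (:- v₂) :* (:- w₂) :+ (v₁ :* w₁ :+ con (+ 0))
              := w₁ :* v₁ :+ w₂ :* v₂) refl v₁ v₂ w₁ w₂)
    ; D-diagonal = λ where
        zero       zero       0≢0 → ⊥-elim (0≢0 refl)
        zero       (suc zero) _   → refl
        (suc zero) zero       _   → refl
        (suc zero) (suc zero) 1≢1 → ⊥-elim (1≢1 refl)
    ; A≋PDP⁻¹ = λ where
        zero       zero       → sym (trans (conjugate-entry v₁ (- w₂) x y w₁ (- v₂) refl refl (P⊠P⁻¹ zero zero)) (δ≡1 _ _))
        zero       (suc zero) → sym (trans (conjugate-entry v₁ (- w₂) x y w₂ v₁ refl refl (P⊠P⁻¹ zero (suc zero))) (δ≡0 _ _))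
        (suc zero) zero       → sym (trans (conjugate-entry v₂ w₁ x y w₁ (- v₂) refl refl (P⊠P⁻¹ (suc zero) zero)) (δ≡0 _ _))
        (suc zero) (suc zero) → sym (trans (conjugate-entry v₂ w₁ x y w₂ v₁ refl refl (P⊠P⁻¹ (suc zero) (suc zero))) (δ≡1 _ _))
    }
    where
    P P⁻¹ D : Matrix 2
    P   = matrix (mat v₁ (- w₂) v₂ w₁)
    P⁻¹ = matrix (mat w₁ w₂ (- v₂) v₁)
    D   = matrix (mat x 0# 0# y)
    unit : ∀ {z} → z ≡ w₁ * v₁ + w₂ * v₂ → z ≡ 1#
    unit eq = trans eq w·v≡1
    P⊠P⁻¹ : P ⊠ P⁻¹ ≋ identity
    P⊠P⁻¹ zero       zero       = unit (solve 4 (λ v₁ v₂ w₁ w₂ →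
          v₁ :* w₁ :+ ((:- w₂) :* (:- v₂) :+ con (+ 0)) := w₁ :* v₁ :+ w₂ :* v₂) refl v₁ v₂ w₁ w₂)
    P⊠P⁻¹ zero       (suc zero) = solve 2 (λ v₁ w₂ →
          v₁ :* w₂ :+ ((:- w₂) :* v₁ :+ con (+ 0)) := con (+ 0)) refl v₁ w₂
    P⊠P⁻¹ (suc zero) zero       = solve 2 (λ v₂ w₁ →
          v₂ :* w₁ :+ (w₁ :* (:- v₂) :+ con (+ 0)) := con (+ 0)) refl v₂ w₁
    P⊠P⁻¹ (suc zero) (suc zero) = unit (solve 4 (λ v₁ v₂ w₁ w₂ →
          v₂ :* w₂ :+ (w₁ :* v₁ :+ con (+ 0)) := w₁ :* v₁ :+ w₂ :* v₂) refl v₁ v₂ w₁ w₂)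

  -- Diagonalizability yields only vectors with w·v = 1; the last hypothesis, which expresses
  -- locality, brings them into a chart.
  cardinality : ∀ {T N} → T Enumerates IsSpectral → Fin N ↔ T →
    (∀ v w → dot w v ≡ 1# → ∃[ f ] outer v w ≡ projection f) →
    HasCardinality (Diag 2 commutativeRing) N
  cardinality {T} {N} E Fin↔T chart = record
    { to = to
    ; cong = λ { refl i j → refl }
    ; bijective =
        (λ {i} {j} eq → to-injective (E.injective (entries-cong eq))) ,
        λ (A , d) → let i , eq = surjective (A , d) in i , λ { refl → eq }
    }
    where
    module E = _Enumerates_ E
    open Inverse Fin↔T using (strictlyInverseˡ; strictlyInverseʳ) renaming (to to index; from to index⁻¹)

    diagonalizable : ∀ {A} → IsSpectral A → Diagonalizable (matrix A)
    diagonalizable (x , y , f , refl) = pencil⇒diagonalizable x y (column f) (row f) (dot-row-column f)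

    to : Fin N → Σ (Matrix 2) Diagonalizable
    to i = matrix (E.element (index i)) , diagonalizable (E.sound (index i))

    to-injective : ∀ {i j} → index i ≡ index j → i ≡ j
    to-injective {i} {j} eq = trans (sym (strictlyInverseʳ i)) (trans (cong index⁻¹ eq) (strictlyInverseʳ j))

    surjective : (A : Σ (Matrix 2) Diagonalizable) → ∃[ i ] proj₁ (to i) ≋ proj₁ A
    surjective (A , d) =
      let x , y , v , w , w·v≡1 , A≡ = diagonalizable⇒pencil d
          f , vw≡ = chart v w w·v≡1
          t , t≡ = E.complete (x , y , f , trans A≡ (cong (pencil x y) vw≡))
      in index⁻¹ t , entries-injective (trans (cong E.element (strictlyInverseˡ t)) t≡)

open import Data.Nat.Base using (_+_; _*_; _∸_; _^_; _≤_; _<_)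
open import Data.Nat.DivMod

-- Digit expansions of residues modulo prime powers

coprime-* : ∀ {r m n} → Coprime r m → Coprime r n → Coprime r (m * n)
coprime-* c c′ (d∣r , d∣mn) =
  c′ (d∣r , coprime-divisor (λ (e∣d , e∣m) → c (∣-trans e∣d d∣r , e∣m)) d∣mn)

coprime-^ : ∀ {r m} → Coprime r m → ∀ k → Coprime r (m ^ k)
coprime-^ c zero   (_ , d∣1) = ∣1⇒≡1 d∣1
coprime-^ c (suc k) = coprime-* c (coprime-^ c k)

prime∤⇒coprime : ∀ {p r} → Prime p → ¬ (p ∣ r) → Coprime r p
prime∤⇒coprime p-prime p∤r (d∣r , d∣p) with prime⇒irreducible p-prime d∣p
... | inj₁ d≡1 = d≡1
... | inj₂ refl = ⊥-elim (p∤r d∣r)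

*-%-distrib : ∀ p x n .{{_ : NonZero p}} .{{_ : NonZero n}} .{{_ : NonZero (p * n)}} → p * (x % n) ≡ (p * x) % (p * n)
*-%-distrib p x n = begin
  p * (x % n)             ≡⟨ ℕ.*-comm p (x % n) ⟩
  x % n * p               ≡⟨ m%n*o≡m*o%[n*o] x n p ⟩
  (x * p) % (n * p)     ≡⟨ cong (_% (n * p)) (ℕ.*-comm x p) ⟩
  (p * x) % (n * p)     ≡⟨ %-congʳ (ℕ.*-comm n p) ⟩
  (p * x) % (p * n)     ∎
  where
  open ≡-Reasoning
  instance _ = ℕ.m*n≢0 n p

module PrimePower {p : ℕ} (p-prime : Prime p) (k : ℕ) where
  private instance
    p≢0 : NonZero p
    p≢0 = prime⇒nonZero p-prime
    pᵏ≢0 : NonZero (p ^ k)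
    pᵏ≢0 = prime^-nonZero p-prime k
    pᵏ⁺¹≢0 : NonZero (p ^ suc k)
    pᵏ⁺¹≢0 = prime^-nonZero p-prime (suc k)

  module R = Residue (p ^ suc k)
  module S = Residue (p ^ k)
  open R using (_⊕_; _⊗_)
  open BaseP R.isCommutativeRing S.isCommutativeRing p using (Expansion)
  open ≡-Reasoning

  private
    τ : Fin p → Fin (p ^ suc k)
    τ a = R.[ toℕ a ]

    φ : Fin (p ^ k) → Fin (p ^ suc k)
    φ s = R.[ p * toℕ s ]

    π : Fin (p ^ suc k) → Fin (p ^ k)
    π r = S.[ toℕ r ]

    φ-[] : ∀ x → φ S.[ x ] ≡ R.[ p * x ]
    φ-[] x = R.[]-cong (begin
      (p * toℕ S.[ x ]) % p ^ suc k           ≡⟨ cong (λ n → (p * n) % p ^ suc k) (S.toℕ-[] x) ⟩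
      (p * (x % p ^ k)) % p ^ suc k           ≡⟨ cong (_% p ^ suc k) (*-%-distrib p x (p ^ k)) ⟩
      (p * x) % p ^ suc k % p ^ suc k         ≡⟨ m%n%n≡m%n (p * x) (p ^ suc k) ⟩
      (p * x) % p ^ suc k                     ∎)

    π-[] : ∀ x → π R.[ x ] ≡ S.[ x ]
    π-[] x = S.[]-cong (trans (cong (_% p ^ k) (R.toℕ-[] x))
      (m∣n⇒o%n%m≡o%m (p ^ k) (p ^ suc k) x (divides p refl)))

    toℕ-digits : ∀ a s → toℕ (τ a ⊕ φ s) ≡ p * toℕ s + toℕ a
    toℕ-digits a s = begin
      toℕ (τ a ⊕ φ s)                                 ≡⟨ cong toℕ (R.[]-+ (toℕ a) (p * toℕ s)) ⟩
      toℕ R.[ toℕ a + p * toℕ s ]                 ≡⟨ R.toℕ-[] (toℕ a + p * toℕ s) ⟩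
      (toℕ a + p * toℕ s) % p ^ suc k
        ≡⟨ cong (_% p ^ suc k) (ℕ.+-comm (toℕ a) (p * toℕ s)) ⟩
      (p * toℕ s + toℕ a) % p ^ suc k             ≡⟨ m<n⇒m%n≡m bound ⟩
      p * toℕ s + toℕ a                           ∎
      where
      bound : p * toℕ s + toℕ a < p ^ suc k
      -- `Fin.combine` is the mixed-radix encoding with the same value p·s + a, so its range gives
      -- the bound.
      bound = ≡.subst₂ _<_ (Fin.toℕ-combine s a) (ℕ.*-comm (p ^ k) p) (Fin.toℕ<n (Fin.combine s a))

    digits : ∀ r → ∃₂ λ a s → r ≡ τ a ⊕ φ s
    digits r = toℕ r mod p , S.[ toℕ r / p ] , (begin
      r                                                             ≡⟨ R.[]-toℕ r ⟨
      R.[ toℕ r ]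
        ≡⟨ cong R.[_] (m≡m%n+[m/n]*n (toℕ r) p) ⟩
      R.[ toℕ r % p + toℕ r / p * p ]                           ≡⟨ R.[]-+ (toℕ r % p) (toℕ r / p * p) ⟨
      R.[ toℕ r % p ] ⊕ R.[ toℕ r / p * p ]
        ≡⟨ cong₂ _⊕_ (cong R.[_] (sym (Fin.toℕ-fromℕ< (m%n<n (toℕ r) p)))) (cong R.[_] (ℕ.*-comm (toℕ r / p) p)) ⟩
      τ (toℕ r mod p) ⊕ R.[ p * (toℕ r / p) ]                     ≡⟨ cong (τ (toℕ r mod p) ⊕_) (φ-[] (toℕ r / p)) ⟨
      τ (toℕ r mod p) ⊕ φ S.[ toℕ r / p ]                           ∎)

    digits-injective : ∀ {a a′ s s′} → τ a ⊕ φ s ≡ τ a′ ⊕ φ s′ → a ≡ a′ × s ≡ s′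
    digits-injective {a} {a′} {s} {s′} eq =
      let s≡s′ , a≡a′ = Fin.combine-injective s a s′ a′ (Fin.toℕ-injective (begin
            toℕ (Fin.combine s a)         ≡⟨ Fin.toℕ-combine s a ⟩
            p * toℕ s + toℕ a         ≡⟨ toℕ-digits a s ⟨
            toℕ (τ a ⊕ φ s)               ≡⟨ cong toℕ eq ⟩
            toℕ (τ a′ ⊕ φ s′)             ≡⟨ toℕ-digits a′ s′ ⟩
            p * toℕ s′ + toℕ a′       ≡⟨ Fin.toℕ-combine s′ a′ ⟨
            toℕ (Fin.combine s′ a′)       ∎))
      in a≡a′ , s≡s′

    φ-+ : ∀ s t → φ (s S.⊕ t) ≡ φ s ⊕ φ t
    φ-+ s t = begin
      φ (s S.⊕ t)                                     ≡⟨ φ-[] (toℕ s + toℕ t) ⟩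
      R.[ p * (toℕ s + toℕ t) ]                   ≡⟨ cong R.[_] (ℕ.*-distribˡ-+ p (toℕ s) (toℕ t)) ⟩
      R.[ p * toℕ s + p * toℕ t ]               ≡⟨ R.[]-+ (p * toℕ s) (p * toℕ t) ⟨
      φ s ⊕ φ t                                       ∎

    φ-* : ∀ r s → r ⊗ φ s ≡ φ (π r S.⊗ s)
    φ-* r s = begin
      r ⊗ φ s                                 ≡⟨ R.⊗-comm r (φ s) ⟩
      φ s ⊗ r                                 ≡⟨ R.[]-*ˡ (p * toℕ s) r ⟩
      R.[ p * toℕ s * toℕ r ]
        ≡⟨ cong R.[_] (trans (ℕ.*-assoc p (toℕ s) (toℕ r)) (cong (p *_) (ℕ.*-comm (toℕ s) (toℕ r)))) ⟩
      R.[ p * (toℕ r * toℕ s) ]           ≡⟨ φ-[] (toℕ r * toℕ s) ⟨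
      φ S.[ toℕ r * toℕ s ]                 ≡⟨ cong φ (S.[]-*ˡ (toℕ r) s) ⟨
      φ (π r S.⊗ s)                           ∎

    inverse : ∀ r → Coprime (toℕ r) (p ^ suc k) → ∃[ r⁻¹ ] r ⊗ r⁻¹ ≡ R.[ 1 ]
    inverse r c with coprime-Bézout c
    ... | Bézout.+- x y eq = R.[ x ] , (begin
      r ⊗ R.[ x ]                         ≡⟨ R.⊗-comm r R.[ x ] ⟩
      R.[ x ] ⊗ r                         ≡⟨ R.[]-*ˡ x r ⟩
      R.[ x * toℕ r ]                   ≡⟨ cong R.[_] eq ⟨
      R.[ 1 + y * p ^ suc k ]         ≡⟨ R.[]-cong ([m+kn]%n≡m%n 1 y (p ^ suc k)) ⟩
      R.[ 1 ]                             ∎)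
    -- Over ℕ the Bézout identity may read 1 + x r = y p^(k+1); the inverse of r is then -x.
    ... | Bézout.-+ x y eq = (R.⊖ R.[ x ]) , (begin
      r ⊗ (R.⊖ R.[ x ])                   ≡⟨ RingProperties.-‿distribʳ-* ℤ/q.ring r R.[ x ] ⟨
      R.⊖ (r ⊗ R.[ x ])                   ≡⟨ cong R.⊖_ (trans (R.⊗-comm r R.[ x ]) (R.[]-*ˡ x r)) ⟩
      R.⊖ R.[ x * toℕ r ]               ≡⟨ GroupProperties.inverseˡ-unique ℤ/q.+-group R.[ 1 ] R.[ x * toℕ r ] complement ⟨
      R.[ 1 ]                             ∎)
      where
      module ℤ/q = CommutativeRing (ℤ/ (p ^ suc k))
      complement : R.[ 1 ] ⊕ R.[ x * toℕ r ] ≡ R.[ 0 ]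
      complement = begin
        R.[ 1 ] ⊕ R.[ x * toℕ r ]       ≡⟨ R.[]-+ 1 (x * toℕ r) ⟩
        R.[ 1 + x * toℕ r ]           ≡⟨ cong R.[_] eq ⟩
        R.[ y * p ^ suc k ]             ≡⟨ R.[]-cong ([m+kn]%n≡m%n 0 y (p ^ suc k)) ⟩
        R.[ 0 ]                           ∎

    φ⊎unit : ∀ r → (∃[ s ] φ s ≡ r) ⊎ (∃[ r⁻¹ ] r ⊗ r⁻¹ ≡ R.[ 1 ])
    φ⊎unit r with p ∣? toℕ r
    ... | no p∤r = inj₂ (inverse r (coprime-^ (prime∤⇒coprime p-prime p∤r) (suc k)))
    ... | yes (divides q eq) = inj₁ (S.[ q ] , (begin
      φ S.[ q ]               ≡⟨ φ-[] q ⟩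
      R.[ p * q ]           ≡⟨ cong R.[_] (trans (ℕ.*-comm p q) (sym eq)) ⟩
      R.[ toℕ r ]             ≡⟨ R.[]-toℕ r ⟩
      r                       ∎))

    -- Reducing modulo p, which divides p^(k+1), sends `φ s` to 0 but 1 to 1 % p; equality would
    -- make p divide 1.
    φ≢1 : ∀ s → φ s ≢ R.[ 1 ]
    φ≢1 s eq = ℕ.nonTrivial⇒≢1 {{prime⇒nonTrivial p-prime}} (∣1⇒≡1 (m%n≡0⇒n∣m 1 p (begin
      1 % p                                 ≡⟨ m∣n⇒o%n%m≡o%m p (p ^ suc k) 1 (m∣m*n (p ^ k)) ⟨
      1 % p ^ suc k % p
        ≡⟨ cong (_% p) (trans (sym (R.toℕ-[] 1)) (trans (cong toℕ (sym eq)) (R.toℕ-[] (p * toℕ s)))) ⟩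
      (p * toℕ s) % p ^ suc k % p
        ≡⟨ m∣n⇒o%n%m≡o%m p (p ^ suc k) (p * toℕ s) (m∣m*n (p ^ k)) ⟩
      (p * toℕ s) % p                     ≡⟨ cong (_% p) (ℕ.*-comm p (toℕ s)) ⟩
      (toℕ s * p) % p                     ≡⟨ m*n%n≡0 (toℕ s) p ⟩
      0                                     ∎)))

  expansion : Expansion
  expansion = record
    { τ = τ ; φ = φ ; π = π
    ; digits = digits ; digits-injective = digits-injective
    ; φ-+ = φ-+ ; φ-* = φ-*
    ; π-+ = λ r r′ → trans (π-[] _) (sym (S.[]-+ (toℕ r) (toℕ r′)))
    ; π-* = λ r r′ → trans (π-[] _) (sym (S.[]-* (toℕ r) (toℕ r′)))
    ; π-1 = π-[] 1
    ; π-surjective = λ s → R.[ toℕ s ] , trans (π-[] (toℕ s)) (S.[]-toℕ s)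
    ; φ⊎unit = φ⊎unit ; φ≢1 = φ≢1
    }

-- Counting the index set

decreasingPair↔ : ∀ n → DecreasingPair (suc n) ↔ (DecreasingPair n ⊎ Fin n)
decreasingPair↔ n = mk↔ₛ′ to from to∘from from∘to
  where
  to : DecreasingPair (suc n) → DecreasingPair n ⊎ Fin n
  to ((suc a , zero)  , _)       = inj₂ a
  to ((suc a , suc b) , s<s b<a) = inj₁ ((a , b) , b<a)

  from : DecreasingPair n ⊎ Fin n → DecreasingPair (suc n)
  from (inj₁ ((a , b) , b<a)) = (suc a , suc b) , s<s b<a
  from (inj₂ a)               = (suc a , zero) , z<s

  to∘from : ∀ x → to (from x) ≡ x
  to∘from (inj₁ _) = refl
  to∘from (inj₂ _) = refl

  from∘to : ∀ x → from (to x) ≡ x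
  from∘to ((suc a , zero)  , z<s)   = refl
  from∘to ((suc a , suc b) , s<s _) = refl

-- The binomial coefficient n(n - 1)/2, defined without division.
triangle : ℕ → ℕ
triangle zero    = 0
triangle (suc n) = triangle n + n

Fin-triangle : ∀ n → Fin (triangle n) ↔ DecreasingPair n
Fin-triangle zero    = mk↔ₛ′ (λ ()) (λ { ((() , _) , _) }) (λ { ((() , _) , _) }) (λ ())
Fin-triangle (suc n) =
  ↔-trans Fin.+↔⊎ (↔-trans (Fin-triangle n ⊎-↔ ↔-refl) (↔-sym (decreasingPair↔ n)))

Index : ℕ → ℕ → Set
Index p zero    = ⊤
Index p (suc k) = (Fin p × Index p k) ⊎
  (DecreasingPair p × (Fin (p ^ k) × Fin (p ^ k)) × Chart (Fin (p ^ suc k)) (Fin (p ^ k)))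

count : ℕ → ℕ → ℕ
count p zero    = 1
count p (suc k) = p * count p k +
  triangle p * ((p ^ k * p ^ k) * (p ^ suc k * p ^ suc k + p ^ suc k * p ^ k))

Fin-count : ∀ p k → Fin (count p k) ↔ Index p k
Fin-count p zero    = Fin.1↔⊤
Fin-count p (suc k) =
  ↔-trans Fin.+↔⊎
    (↔-trans Fin.*↔× (↔-refl ×-↔ Fin-count p k) ⊎-↔
     ↔-trans Fin.*↔× (Fin-triangle p ×-↔
       ↔-trans Fin.*↔× (Fin.*↔× ×-↔ ↔-trans Fin.+↔⊎ (Fin.*↔× ⊎-↔ Fin.*↔×))))

module _ {p : ℕ} (p-prime : Prime p) where
  module SpectralModulo (k : ℕ) =
    Spectral (Residue.isCommutativeRing (p ^ k) {{prime^-nonZero p-prime k}})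

  -- Starting from the zero ring ℤ/1, with its single matrix, lets the field ℤ/p be treated by the
  -- general step.
  enumeration : ∀ k → Index p k Enumerates SpectralModulo.IsSpectral k
  enumeration zero = record
    { element   = λ _ → mat zero zero zero zero
    ; sound     = λ _ → zero , zero , inj₁ (zero , zero) , unique _ _
    ; injective = λ _ → refl
    ; complete  = λ _ → tt , unique _ _
    }
    where
    unique-residue : (a b : Fin 1) → a ≡ b
    unique-residue zero zero = refl
    unique : (A B : M₂ (Fin 1)) → A ≡ B
    unique _ _ = mat-cong (unique-residue _ _) (unique-residue _ _) (unique-residue _ _) (unique-residue _ _)
  enumeration (suc k) =
    BaseP.Step.enumerate _ _ p (PrimePower.expansion p-prime k) (enumeration k)

-- Closed form of the recurrence

geometric : ℕ → ℕ → ℕ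
geometric q zero    = 0
geometric q (suc k) = geometric q k + q ^ k

geometric-sum : ∀ c k → c * geometric (1 + c) k + 1 ≡ (1 + c) ^ k
geometric-sum c zero    = cong (_+ 1) (ℕ.*-zeroʳ c)
geometric-sum c (suc k) = begin
  c * (geometric (1 + c) k + (1 + c) ^ k) + 1
    ≡⟨ solve 3 (λ c g q →
          c :* (g :+ q) :+ con 1
          := (c :* g :+ con 1) :+ c :* q) refl c (geometric (1 + c) k) ((1 + c) ^ k) ⟩
  (c * geometric (1 + c) k + 1) + c * (1 + c) ^ k
    ≡⟨ cong (_+ c * (1 + c) ^ k) (geometric-sum c k) ⟩
  (1 + c) ^ k + c * (1 + c) ^ k                     ∎
  where
  open ≡-Reasoning
  open ℕSolver.+-*-Solver

triangle-double : ∀ n → 2 * triangle n + n ≡ n ^ 2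
triangle-double zero    = refl
triangle-double (suc n) = begin
  2 * (triangle n + n) + (1 + n)
    ≡⟨ solve 2 (λ t n →
          con 2 :* (t :+ n) :+ (con 1 :+ n)
          := (con 2 :* t :+ n) :+ (con 1 :+ con 2 :* n)) refl (triangle n) n ⟩
  (2 * triangle n + n) + (1 + 2 * n)    ≡⟨ cong (_+ (1 + 2 * n)) (triangle-double n) ⟩
  n ^ 2 + (1 + 2 * n)
    ≡⟨ solve 1 (λ n → n :^ 2 :+ (con 1 :+ con 2 :* n) := (con 1 :+ n) :^ 2) refl n ⟩
  (1 + n) ^ 2                           ∎
  where
  open ≡-Reasoning
  open ℕSolver.+-*-Solver

-- What remains after the p^k scalar matrices; here `triangle p * (p + 1)` is p(p² - 1)/2.
nonScalar : ℕ → ℕ → ℕ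
nonScalar p k = p ^ k * (triangle p * (p + 1) * geometric (p ^ 3) k)

count-formula : ∀ p k → count p k ≡ p ^ k + nonScalar p k
count-formula p zero    = cong (λ n → 1 + (n + 0)) (sym (ℕ.*-zeroʳ (triangle p * (p + 1))))
count-formula p (suc k) = begin
  p * count p k + triangle p * ((q * q) * ((p * q) * (p * q) + (p * q) * q))
    ≡⟨ cong (λ n → p * n + triangle p * ((q * q) * ((p * q) * (p * q) + (p * q) * q))) (count-formula p k) ⟩
  p * (q + q * (triangle p * (p + 1) * g)) + triangle p * ((q * q) * ((p * q) * (p * q) + (p * q) * q))
    ≡⟨ solve 4 (λ p q t g →
         p :* (q :+ q :* (t :* (p :+ con 1) :* g)) :+ t :* ((q :* q) :* ((p :* q) :* (p :* q) :+ (p :* q) :* q))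
         := p :* q :+ p :* q :* (t :* (p :+ con 1) :* (g :+ q :^ 3))) refl p q (triangle p) g ⟩
  p * q + p * q * (triangle p * (p + 1) * (g + q ^ 3))
    ≡⟨ cong (λ n → p * q + p * q * (triangle p * (p + 1) * (g + n))) power ⟩
  p * q + p * q * (triangle p * (p + 1) * (g + (p ^ 3) ^ k)) ∎
  where
  open ≡-Reasoning
  open ℕSolver.+-*-Solver
  q = p ^ k
  g = geometric (p ^ 3) k
  power : q ^ 3 ≡ (p ^ 3) ^ k
  power = trans (ℕ.^-*-assoc p k 3) (trans (cong (p ^_) (ℕ.*-comm k 3)) (sym (ℕ.^-*-assoc p 3 k)))

nonScalar-scaled : ∀ p .{{_ : NonZero p}} k →
  p ^ (k + 1) * (p ^ 2 ∸ 1) * (p ^ (3 * k) ∸ 1) ≡ nonScalar p k * (2 * (p ^ 3 ∸ 1))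
nonScalar-scaled p k = begin
  p ^ (k + 1) * (p ^ 2 ∸ 1) * (p ^ (3 * k) ∸ 1)
    ≡⟨ cong (λ n → p ^ (k + 1) * (p ^ 2 ∸ 1) * n) geometric-part ⟩
  p ^ (k + 1) * (p ^ 2 ∸ 1) * (c * g)
    ≡⟨ cong (λ n → n * (p ^ 2 ∸ 1) * (c * g)) (trans (ℕ.^-distribˡ-+-* p k 1) (cong (p ^ k *_) (ℕ.*-identityʳ p))) ⟩
  p ^ k * p * (p ^ 2 ∸ 1) * (c * g)
    ≡⟨ solve 5 (λ q p d c g →
          q :* p :* d :* (c :* g) := q :* (p :* d) :* (c :* g)) refl (p ^ k) p (p ^ 2 ∸ 1) c g ⟩
  p ^ k * (p * (p ^ 2 ∸ 1)) * (c * g)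
    ≡⟨ cong (λ n → p ^ k * n * (c * g)) triangle-part ⟩
  p ^ k * (2 * triangle p * (p + 1)) * (c * g)
    ≡⟨ solve 5 (λ q t p c g →
          q :* (con 2 :* t :* (p :+ con 1)) :* (c :* g)
          := q :* (t :* (p :+ con 1) :* g) :* (con 2 :* c)) refl (p ^ k) (triangle p) p c g ⟩
  nonScalar p k * (2 * c) ∎
  where
  open ≡-Reasoning
  open ℕSolver.+-*-Solver
  c = p ^ 3 ∸ 1
  g = geometric (p ^ 3) k

  1+c≡p³ : 1 + c ≡ p ^ 3
  1+c≡p³ = ℕ.m+[n∸m]≡n (ℕ.m^n>0 p 3)

  geometric-part : p ^ (3 * k) ∸ 1 ≡ c * g
  geometric-part = begin
    p ^ (3 * k) ∸ 1                       ≡⟨ cong (_∸ 1) (ℕ.^-*-assoc p 3 k) ⟨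
    (p ^ 3) ^ k ∸ 1                       ≡⟨ cong (λ q → q ^ k ∸ 1) 1+c≡p³ ⟨
    (1 + c) ^ k ∸ 1                       ≡⟨ cong (_∸ 1) (geometric-sum c k) ⟨
    c * geometric (1 + c) k + 1 ∸ 1       ≡⟨ ℕ.m+n∸n≡m (c * geometric (1 + c) k) 1 ⟩
    c * geometric (1 + c) k               ≡⟨ cong (λ q → c * geometric q k) 1+c≡p³ ⟩
    c * g                                 ∎

  triangle-part : p * (p ^ 2 ∸ 1) ≡ 2 * triangle p * (p + 1)
  -- Adding p to both sides absorbs the truncated subtraction, since p(p² ∸ 1) + p = p · p².
  triangle-part = ℕ.+-cancelʳ-≡ p _ _ (begin
    p * (p ^ 2 ∸ 1) + p
      ≡⟨ solve 2 (λ p d → p :* d :+ p := p :* (con 1 :+ d)) refl p (p ^ 2 ∸ 1) ⟩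
    p * (1 + (p ^ 2 ∸ 1))                 ≡⟨ cong (p *_) (ℕ.m+[n∸m]≡n (ℕ.m^n>0 p 2)) ⟩
    p * p ^ 2                             ≡⟨ solve 1 (λ p → p :* p :^ 2 := p :^ 2 :* p) refl p ⟩
    p ^ 2 * p                             ≡⟨ cong (_* p) (triangle-double p) ⟨
    (2 * triangle p + p) * p
      ≡⟨ solve 2 (λ t p → (con 2 :* t :+ p) :* p := con 2 :* t :* p :+ p :^ 2) refl (triangle p) p ⟩
    2 * triangle p * p + p ^ 2            ≡⟨ cong (λ n → 2 * triangle p * p + n) (triangle-double p) ⟨
    2 * triangle p * p + (2 * triangle p + p)
      ≡⟨ solve 2 (λ t p →
            con 2 :* t :* p :+ (con 2 :* t :+ p)
            := con 2 :* t :* (p :+ con 1) :+ p) refl (triangle p) p ⟩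
    2 * triangle p * (p + 1) + p          ∎)

/-exact : ∀ m n .{{_ : NonZero n}} → + (m * n) ℚ./ n ≡ + m ℚ./ 1
/-exact m (suc n) = ℚ.fromℚᵘ-cong {ℚᵘ.mkℚᵘ (+ (m * suc n)) n} {ℚᵘ.mkℚᵘ (+ m) 0}
  (ℚᵘ.*≡* (trans (ℤ.*-identityʳ _) (ℤ.pos-* m (suc n))))

-- Rationals are kept in lowest terms, so the sum does not simply compute; the check is made on
-- unnormalised fractions.
/1-homo-+ : ∀ m n → + (m + n) ℚ./ 1 ≡ (+ m ℚ./ 1) ℚ.+ (+ n ℚ./ 1)
/1-homo-+ m n = ℚ.toℚᵘ-injective (begin
  ℚ.toℚᵘ (+ (m + n) ℚ./ 1)                          ≈⟨ ℚ.toℚᵘ-fromℚᵘ (ℚᵘ.mkℚᵘ (+ (m + n)) 0) ⟩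
  ℚᵘ.mkℚᵘ (+ (m + n)) 0                             ≈⟨ ℚᵘ.*≡* (cong (ℤ._* + 1) (cong₂ ℤ._+_ (sym (ℤ.*-identityʳ (+ m))) (sym (ℤ.*-identityʳ (+ n))))) ⟩
  ℚᵘ.mkℚᵘ (+ m) 0 ℚᵘ.+ ℚᵘ.mkℚᵘ (+ n) 0              ≈⟨ ℚᵘ.+-cong (ℚ.toℚᵘ-fromℚᵘ (ℚᵘ.mkℚᵘ (+ m) 0)) (ℚ.toℚᵘ-fromℚᵘ (ℚᵘ.mkℚᵘ (+ n) 0)) ⟨
  ℚ.toℚᵘ (+ m ℚ./ 1) ℚᵘ.+ ℚ.toℚᵘ (+ n ℚ./ 1)        ≈⟨ ℚ.toℚᵘ-homo-+ (+ m ℚ./ 1) (+ n ℚ./ 1) ⟨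
  ℚ.toℚᵘ ((+ m ℚ./ 1) ℚ.+ (+ n ℚ./ 1))              ∎)
  where open ℚᵘ.≃-Reasoning

theorem4p1 : (p k : ℕ) (p-prime : Prime p) → 1 ≤ k →
    ∃[ N ] HasCardinality (Diag 2 (ℤ/ (p ^ k) {{prime^-nonZero p-prime k}})) N ×
    + N ℚ./ 1 ≡
    (+ (p ^ k) ℚ./ 1) ℚ.+
    ℚ._/_ (+ (p ^ (k + 1) * (p ^ 2 ∸ 1) * (p ^ (3 * k) ∸ 1)))
    (2 * (p ^ 3 ∸ 1)) {{2[p³∸1]-nonZero p-prime}}
theorem4p1 p k@(suc k-1) p-prime _ = count p k , cardinality , (begin
  + count p k ℚ./ 1
    ≡⟨ cong (λ n → + n ℚ./ 1) (count-formula p k) ⟩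
  + (p ^ k + nonScalar p k) ℚ./ 1                         ≡⟨ /1-homo-+ (p ^ k) (nonScalar p k) ⟩
  (+ (p ^ k) ℚ./ 1) ℚ.+ (+ nonScalar p k ℚ./ 1)           ≡⟨ cong ((+ (p ^ k) ℚ./ 1) ℚ.+_) (/-exact (nonScalar p k) d) ⟨
  (+ (p ^ k) ℚ./ 1) ℚ.+ (+ (nonScalar p k * d) ℚ./ d)     ≡⟨ cong (λ n → (+ (p ^ k) ℚ./ 1) ℚ.+ (+ n ℚ./ d)) (nonScalar-scaled p k) ⟨
  (+ (p ^ k) ℚ./ 1) ℚ.+ (+ (p ^ (k + 1) * (p ^ 2 ∸ 1) * (p ^ (3 * k) ∸ 1)) ℚ./ d) ∎)
  where
  open ≡-Reasoning
  instance
    p≢0 : NonZero p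
    p≢0 = prime⇒nonZero p-prime
    pᵏ≢0 : NonZero (p ^ k)
    pᵏ≢0 = prime^-nonZero p-prime k
    d≢0 : NonZero (2 * (p ^ 3 ∸ 1))
    d≢0 = 2[p³∸1]-nonZero p-prime
  d = 2 * (p ^ 3 ∸ 1)

  cardinality : HasCardinality (Diag 2 (ℤ/ (p ^ k))) (count p k)
  cardinality = Diagonalization.cardinality (Residue.isCommutativeRing (p ^ k))
    (enumeration p-prime k) (Fin-count p k)
    -- Because k is a successor, ℤ/p^k has an expansion over ℤ/p^(k-1), and `normalise` supplies the
    -- chart.
    (λ v w w·v≡1 → let f , eq = normalise v w w·v≡1 in include f , eq)
    where open BaseP.Step _ _ p (PrimePower.expansion p-prime k-1) using (normalise; include)
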